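{- For every integer $k\ge 4$, every positive integer $n$ is a sum of $k$ nonzero triangular numbers, except for $n=1,2,\ldots,k-1$, $n=k+1$, and $n=k+3$.
   Context: A triangular number is a number of the form $x(x+1)/2$ with $x\in\mathbb{Z}$; nonzero means its value is nonzero. -}

module Defs where

open import Data.Nat using (ℕ; _+_; _*_)
open import Data.Integer as ℤ using (ℤ; +_)
open import Data.Fin using (Fin)
open import Data.Product using (Σ; ∃; _×_)
open import Data.Vec.Functional using (Vector; foldr)
open import Relation.Binary.PropositionalEquality using (_≡_; _≢_)

-- t is a triangular number: t = x(x+1)/2 for some integer x
-- (stated without division as 2t = x(x+1)).  Triangular numbers are
-- nonnegative, so values are taken in ℕ.
IsTriangular : ℕ → Set
IsTriangular t = ∃ λ (x : ℤ) → + (2 * t) ≡ x ℤ.* (x ℤ.+ + 1)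

IsNonzeroTriangular : ℕ → Set
IsNonzeroTriangular t = (t ≢ 0) × IsTriangular t

vsum : ∀ {k} → Vector ℕ k → ℕ
vsum = foldr _+_ 0

SumOfNonzeroTriangulars : ℕ → ℕ → Set
SumOfNonzeroTriangulars k n =
  Σ (Vector ℕ k) λ t → ((i : Fin k) → IsNonzeroTriangular (t i)) × vsum t ≡ n

{-# OPTIONS --safe #-}
module Submission where

-- Twice a triangular number is a pronic number a (a + 1) with a ∈ ℤ, and four pronic numbers summing to 2 n
-- are the same as four odd squares (2 a + 1)² summing to 4 (2 n + 1).  They exist by Lagrange's theorem for
-- 2 n + 1.  If one of the odd numbers is ±1, reflect the vector (1 , x , y , z) of odd numbers in a vector
-- (1 , ±1 , ±1 , 0) of norm 3, or in (1 , 1 , 1 , 1).  Each reflection produces an entry ±1 again only if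
-- (x , y) lies on one of finitely many lines; the lines of all available reflections meet in a few small
-- points, so the failures have n ≤ 135, where a search decides.  For k > 4 summands add ones.  Conversely a
-- nonzero triangular number exceeds 1 by 0, by 2 or by at least 4, and this set is closed under addition.

open import Defs
open import Data.Nat as ℕ using (ℕ; zero; suc; _≤_; _<_; s≤s; z≤n; NonZero)
import Data.Nat.Properties as ℕₚ
open import Data.Nat.Induction using (<-rec)
import Data.Nat.Divisibility as ℕᵈ
open import Data.Nat.Divisibility.Core using (hasNonTrivialDivisor)
import Data.Nat.DivMod as ℕᵐ
open import Data.Nat.Primality using (Prime; prime?; ¬prime⇒composite; euclidsLemma; prime⇒irreducible; ¬prime[1])
import Data.Nat.Tactic.RingSolver as ℕ-Solver
open import Data.Integer as ℤ using (ℤ; +_; -[1+_]; _+_; _*_; _-_; -_; ∣_∣; 0ℤ; 1ℤ; -1ℤ)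
import Data.Integer.Properties as ℤₚ
open import Data.Integer.DivMod using (_/ℕ_; _%ℕ_; n%ℕd<d; a≡a%ℕn+[a/ℕn]*n)
open import Data.Integer.Divisibility.Signed as ℤᵈ using (∣ᵤ⇒∣; ∣⇒∣ᵤ)
open import Data.Integer.Tactic.RingSolver using (solve-∀)
open import Data.Integer.Solver using (module +-*-Solver)
open +-*-Solver using (Polynomial; solve; con; _:+_; _:*_; _:-_; _:=_)
open import Data.Fin using (Fin; zero; suc; toℕ; fromℕ<; splitAt; join)
import Data.Fin.Properties as Finₚ
open import Data.List using (List; []; _∷_)
open import Data.List.Relation.Unary.All as All using (All; all?)
open import Data.List.Relation.Unary.Any using (here; there)
open import Data.List.Membership.Propositional using (_∈_)
open import Data.Vec.Functional using () renaming (_∷_ to _∷ᵥ_)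
open import Data.Product using (∃; ∃₂; _×_; _,_; proj₁; proj₂)
open import Data.Sum using (_⊎_; inj₁; inj₂)
open import Data.Empty using (⊥-elim)
open import Function using (_∘_)
open import Function.Bundles using (_⇔_; mk⇔)
open import Relation.Binary.PropositionalEquality using (_≡_; _≢_; refl; sym; trans; cong; cong₂; subst; subst₂; module ≡-Reasoning)
open import Relation.Nullary using (¬_; Dec; yes; no; contradiction)
open import Relation.Nullary.Decidable using (_×-dec_; _⊎-dec_; from-yes; from-no)

-- Lagrange's four-square theorem

sumSq : ℤ → ℤ → ℤ → ℤ → ℤ
sumSq a b c d = a * a + b * b + c * c + d * d

IsSumOfFourSquares : ℤ → Set
IsSumOfFourSquares n = ∃₂ λ a b → ∃₂ λ c d → n ≡ sumSq a b c d

-- Multiplicativity of the quaternion norm. The first square is that of the inner product, and the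
-- other three are built from 2 by 2 minors; for vectors congruent modulo `m` those minors are
-- multiples of `m`, which the descent exploits.
euler-identity : ∀ a b c d x y z w →
  (a * a + b * b + c * c + d * d) * (x * x + y * y + z * z + w * w) ≡
    (a * x + b * y + c * z + d * w) * (a * x + b * y + c * z + d * w)
  + (a * y - b * x + c * w - d * z) * (a * y - b * x + c * w - d * z)
  + (a * z - c * x + d * y - b * w) * (a * z - c * x + d * y - b * w)
  + (a * w - d * x + b * z - c * y) * (a * w - d * x + b * z - c * y)
euler-identity = solve-∀

fourSquares-* : ∀ {m n} → IsSumOfFourSquares m → IsSumOfFourSquares n → IsSumOfFourSquares (m * n)
fourSquares-* (a , b , c , d , refl) (x , y , z , w , refl) =
  a * x + b * y + c * z + d * w , a * y - b * x + c * w - d * z ,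
  a * z - c * x + d * y - b * w , a * w - d * x + b * z - c * y ,
  euler-identity a b c d x y z w

square-abs : ∀ i → i * i ≡ + (∣ i ∣ ℕ.* ∣ i ∣)
square-abs (+ n)    = sym (ℤₚ.pos-* n n)
square-abs -[1+ n ] = refl

sumSq-abs : ∀ a b c d → sumSq a b c d ≡
  + (∣ a ∣ ℕ.* ∣ a ∣ ℕ.+ ∣ b ∣ ℕ.* ∣ b ∣ ℕ.+ ∣ c ∣ ℕ.* ∣ c ∣ ℕ.+ ∣ d ∣ ℕ.* ∣ d ∣)
sumSq-abs a b c d = cong₂ _+_ (cong₂ _+_ (cong₂ _+_ (square-abs a) (square-abs b)) (square-abs c)) (square-abs d)

-- Descent from a multiple of a prime to the prime

centred-residue : ∀ m .{{_ : NonZero m}} x → ∃ λ k → ∣ + 2 * (x - + m * k) ∣ ℕ.≤ m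
centred-residue m x with a≡a%ℕn+[a/ℕn]*n x m | n%ℕd<d x m
... | eq | r<m with 2 ℕ.* (x %ℕ m) ℕ.≤? m
...   | yes 2r≤m = x /ℕ m , subst (ℕ._≤ m) (sym (trans (cong ∣_∣ e) (ℤₚ.abs-* (+ 2) (+ (x %ℕ m))))) 2r≤m
  where
  lem : ∀ r q m → + 2 * (r + q * m - m * q) ≡ + 2 * r
  lem = solve-∀
  e : + 2 * (x - + m * (x /ℕ m)) ≡ + 2 * + (x %ℕ m)
  e = trans (cong (λ t → + 2 * (t - + m * (x /ℕ m))) eq) (lem (+ (x %ℕ m)) (x /ℕ m) (+ m))
-- A remainder `r` above m / 2 is replaced by `r - m`. Bounding the doubled residue avoids rounding
-- m / 2.
...   | no 2r≰m = x /ℕ m + 1ℤ , subst (ℕ._≤ m) (sym abs-eq) bound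
  where
  r = x %ℕ m
  lem : ∀ r q m → + 2 * (r + q * m - m * (q + + 1)) ≡ - (+ 2 * (m - r))
  lem = solve-∀
  e : + 2 * (x - + m * (x /ℕ m + 1ℤ)) ≡ - (+ 2 * (+ m - + r))
  e = trans (cong (λ t → + 2 * (t - + m * (x /ℕ m + 1ℤ))) eq) (lem (+ r) (x /ℕ m) (+ m))
  abs-eq : ∣ + 2 * (x - + m * (x /ℕ m + 1ℤ)) ∣ ≡ 2 ℕ.* (m ℕ.∸ r)
  abs-eq = begin
    ∣ + 2 * (x - + m * (x /ℕ m + 1ℤ)) ∣ ≡⟨ cong ∣_∣ e ⟩
    ∣ - (+ 2 * (+ m - + r)) ∣           ≡⟨ ℤₚ.∣-i∣≡∣i∣ (+ 2 * (+ m - + r)) ⟩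
    ∣ + 2 * (+ m - + r) ∣               ≡⟨ ℤₚ.abs-* (+ 2) (+ m - + r) ⟩
    2 ℕ.* ∣ + m - + r ∣                 ≡⟨ cong (λ t → 2 ℕ.* ∣ t ∣) (trans (ℤₚ.m-n≡m⊖n m r) (ℤₚ.⊖-≥ (ℕₚ.<⇒≤ r<m))) ⟩
    2 ℕ.* (m ℕ.∸ r)                     ∎
    where open ≡-Reasoning
  bound : 2 ℕ.* (m ℕ.∸ r) ℕ.≤ m
  bound = begin
    2 ℕ.* (m ℕ.∸ r)       ≡⟨ ℕₚ.*-distribˡ-∸ 2 m r ⟩
    2 ℕ.* m ℕ.∸ 2 ℕ.* r   ≤⟨ ℕₚ.∸-monoʳ-≤ (2 ℕ.* m) (ℕₚ.≰⇒≥ 2r≰m) ⟩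
    2 ℕ.* m ℕ.∸ m         ≡⟨ ℕₚ.m+n∸m≡n m (m ℕ.+ 0) ⟩
    m ℕ.+ 0               ≡⟨ ℕₚ.+-identityʳ m ⟩
    m                     ∎
    where open ℕₚ.≤-Reasoning

-- Meant for `a`, `b`, `c`, `d` the absolute values of the doubled residues. Each square is at most
-- `m * m`, so `r ≤ m`. If `r` is 0 all four vanish, and if `r` is `m` all four equal `m`; either
-- way `m` divides everything, which the descent turns into a contradiction.
squares-extremal : ∀ m .{{_ : NonZero m}} r {a b c d} → a ℕ.≤ m → b ℕ.≤ m → c ℕ.≤ m → d ℕ.≤ m →
  a ℕ.* a ℕ.+ b ℕ.* b ℕ.+ c ℕ.* c ℕ.+ d ℕ.* d ≡ 4 ℕ.* (m ℕ.* r) →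
  (1 ℕ.≤ r × r ℕ.< m) ⊎ (m ℕᵈ.∣ r × m ℕᵈ.∣ a × m ℕᵈ.∣ b × m ℕᵈ.∣ c × m ℕᵈ.∣ d)
squares-extremal m r {a} {b} {c} {d} a≤m b≤m c≤m d≤m eq with r ℕ.≟ 0
... | yes refl = inj₂ (m ℕᵈ.∣0 , z a a²≡0 , z b b²≡0 , z c c²≡0 , z d d²≡0)
  where
  Σ≡0 : a ℕ.* a ℕ.+ b ℕ.* b ℕ.+ c ℕ.* c ℕ.+ d ℕ.* d ≡ 0
  Σ≡0 = trans eq (cong (4 ℕ.*_) (ℕₚ.*-zeroʳ m))
  abc≡0 = ℕₚ.m+n≡0⇒m≡0 (a ℕ.* a ℕ.+ b ℕ.* b ℕ.+ c ℕ.* c) Σ≡0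
  ab≡0 = ℕₚ.m+n≡0⇒m≡0 (a ℕ.* a ℕ.+ b ℕ.* b) abc≡0
  a²≡0 = ℕₚ.m+n≡0⇒m≡0 (a ℕ.* a) ab≡0
  b²≡0 = ℕₚ.m+n≡0⇒n≡0 (a ℕ.* a) ab≡0
  c²≡0 = ℕₚ.m+n≡0⇒n≡0 (a ℕ.* a ℕ.+ b ℕ.* b) abc≡0
  d²≡0 = ℕₚ.m+n≡0⇒n≡0 (a ℕ.* a ℕ.+ b ℕ.* b ℕ.+ c ℕ.* c) Σ≡0
  z : ∀ x → x ℕ.* x ≡ 0 → m ℕᵈ.∣ x
  z zero    _ = m ℕᵈ.∣0
... | no r≢0 with r ℕ.<? m
...   | yes r<m = inj₁ (ℕₚ.n≢0⇒n>0 r≢0 , r<m)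
...   | no r≮m = inj₂ (full (sym r≡m) , full a≡m , full b≡m , full c≡m , full d≡m)
  where
  full : ∀ {x} → x ≡ m → m ℕᵈ.∣ x
  full refl = ℕᵈ.∣-refl
  sq≤ : ∀ {x} → x ℕ.≤ m → x ℕ.* x ℕ.≤ m ℕ.* m
  sq≤ p = ℕₚ.*-mono-≤ p p
  4mm : 4 ℕ.* (m ℕ.* m) ≡ m ℕ.* m ℕ.+ m ℕ.* m ℕ.+ m ℕ.* m ℕ.+ m ℕ.* m
  4mm = lem m
    where
    lem : ∀ m → 4 ℕ.* (m ℕ.* m) ≡ m ℕ.* m ℕ.+ m ℕ.* m ℕ.+ m ℕ.* m ℕ.+ m ℕ.* m
    lem = ℕ-Solver.solve-∀
  upper : 4 ℕ.* (m ℕ.* r) ℕ.≤ 4 ℕ.* (m ℕ.* m)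
  upper = subst₂ ℕ._≤_ eq (sym 4mm)
    (ℕₚ.+-mono-≤ (ℕₚ.+-mono-≤ (ℕₚ.+-mono-≤ (sq≤ a≤m) (sq≤ b≤m)) (sq≤ c≤m)) (sq≤ d≤m))
  r≡m : m ≡ r
  r≡m = ℕₚ.≤-antisym (ℕₚ.≮⇒≥ r≮m) (ℕₚ.*-cancelˡ-≤ m (ℕₚ.*-cancelˡ-≤ 4 upper))
  eq′ : a ℕ.* a ℕ.+ b ℕ.* b ℕ.+ c ℕ.* c ℕ.+ d ℕ.* d ≡ m ℕ.* m ℕ.+ m ℕ.* m ℕ.+ m ℕ.* m ℕ.+ m ℕ.* m
  eq′ = trans eq (trans (cong (λ t → 4 ℕ.* (m ℕ.* t)) (sym r≡m)) 4mm)
  split : ∀ {s t u v} → s ℕ.≤ u → t ℕ.≤ v → s ℕ.+ t ≡ u ℕ.+ v → s ≡ u × t ≡ v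
  split {s} {t} {u} {v} s≤u t≤v e = s≡u , ℕₚ.+-cancelˡ-≡ s t v (trans e (cong (ℕ._+ v) (sym s≡u)))
    where
    s≡u : s ≡ u
    s≡u = ℕₚ.≤-antisym s≤u (ℕₚ.+-cancelʳ-≤ v u s (subst (ℕ._≤ s ℕ.+ v) e (ℕₚ.+-monoʳ-≤ s t≤v)))
  root : ∀ {x} → x ℕ.≤ m → x ℕ.* x ≡ m ℕ.* m → x ≡ m
  root {x} x≤m e with ℕₚ.m≤n⇒m<n∨m≡n x≤m
  ... | inj₂ x≡m = x≡m
  ... | inj₁ x<m = contradiction e (ℕₚ.<⇒≢ (ℕₚ.*-mono-< x<m x<m))
  s₁ = split (ℕₚ.+-mono-≤ (ℕₚ.+-mono-≤ (sq≤ a≤m) (sq≤ b≤m)) (sq≤ c≤m)) (sq≤ d≤m) eq′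
  s₂ = split (ℕₚ.+-mono-≤ (sq≤ a≤m) (sq≤ b≤m)) (sq≤ c≤m) (proj₁ s₁)
  s₃ = split (sq≤ a≤m) (sq≤ b≤m) (proj₁ s₂)
  a≡m = root a≤m (proj₁ s₃)
  b≡m = root b≤m (proj₂ s₃)
  c≡m = root c≤m (proj₂ s₂)
  d≡m = root d≤m (proj₂ s₁)

-- The `y`s are residues of the `x`s modulo `m`, `r` is the cofactor with `m * r` equal to the sum
-- of their squares, and the `w`s are the four bilinear forms of `euler-identity` in `x` and `y`,
-- divided by `m`.
module Descent (m x₁ x₂ x₃ x₄ k₁ k₂ k₃ k₄ p : ℤ) where

  y₁ y₂ y₃ y₄ r w₁ w₂ w₃ w₄ : ℤ
  y₁ = x₁ - m * k₁
  y₂ = x₂ - m * k₂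
  y₃ = x₃ - m * k₃
  y₄ = x₄ - m * k₄
  r = p - + 2 * (x₁ * k₁ + x₂ * k₂ + x₃ * k₃ + x₄ * k₄) + m * sumSq k₁ k₂ k₃ k₄
  w₁ = p - (x₁ * k₁ + x₂ * k₂ + x₃ * k₃ + x₄ * k₄)
  w₂ = x₂ * k₁ - x₁ * k₂ + x₄ * k₃ - x₃ * k₄
  w₃ = x₃ * k₁ - x₁ * k₃ + x₂ * k₄ - x₄ * k₂
  w₄ = x₄ * k₁ - x₁ * k₄ + x₃ * k₂ - x₂ * k₃

  -- Serves to show that `m` divides `p` in the extremal cases. Only the doubles of the `y`s occur
  -- because only their divisibility by `m` is known there.
  p-expansion : p ≡ r + (k₁ * (+ 2 * y₁) + k₂ * (+ 2 * y₂) + k₃ * (+ 2 * y₃) + k₄ * (+ 2 * y₄))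
                      + sumSq k₁ k₂ k₃ k₄ * m
  p-expansion = lem m x₁ x₂ x₃ x₄ k₁ k₂ k₃ k₄ p
    where
    lem : ∀ m x₁ x₂ x₃ x₄ k₁ k₂ k₃ k₄ p → p ≡
      p - + 2 * (x₁ * k₁ + x₂ * k₂ + x₃ * k₃ + x₄ * k₄) + m * (k₁ * k₁ + k₂ * k₂ + k₃ * k₃ + k₄ * k₄)
      + (k₁ * (+ 2 * (x₁ - m * k₁)) + k₂ * (+ 2 * (x₂ - m * k₂)) + k₃ * (+ 2 * (x₃ - m * k₃)) + k₄ * (+ 2 * (x₄ - m * k₄)))
      + (k₁ * k₁ + k₂ * k₂ + k₃ * k₃ + k₄ * k₄) * m
    lem = solve-∀

  module _ (mp≡Σx² : m * p ≡ sumSq x₁ x₂ x₃ x₄) where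

    mr≡Σy² : m * r ≡ sumSq y₁ y₂ y₃ y₄
    mr≡Σy² = trans (lem₁ m (x₁ * k₁ + x₂ * k₂ + x₃ * k₃ + x₄ * k₄) (sumSq k₁ k₂ k₃ k₄) p)
      (trans (cong (λ t → t - + 2 * m * (x₁ * k₁ + x₂ * k₂ + x₃ * k₃ + x₄ * k₄) + m * m * sumSq k₁ k₂ k₃ k₄) mp≡Σx²)
        (lem₂ m x₁ x₂ x₃ x₄ k₁ k₂ k₃ k₄))
      where
      lem₁ : ∀ m s t p → m * (p - + 2 * s + m * t) ≡ m * p - + 2 * m * s + m * m * t
      lem₁ = solve-∀
      lem₂ : ∀ m x₁ x₂ x₃ x₄ k₁ k₂ k₃ k₄ →
        x₁ * x₁ + x₂ * x₂ + x₃ * x₃ + x₄ * x₄ - + 2 * m * (x₁ * k₁ + x₂ * k₂ + x₃ * k₃ + x₄ * k₄)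
          + m * m * (k₁ * k₁ + k₂ * k₂ + k₃ * k₃ + k₄ * k₄) ≡
        (x₁ - m * k₁) * (x₁ - m * k₁) + (x₂ - m * k₂) * (x₂ - m * k₂)
          + (x₃ - m * k₃) * (x₃ - m * k₃) + (x₄ - m * k₄) * (x₄ - m * k₄)
      lem₂ = solve-∀

    -- Multiply the two sums of squares, `m * p` and `m * r`, by Euler's identity. As `y` is
    -- congruent to `x`, every resulting `z` is `m` times a `w`, and the factor m² cancels.
    rp≡Σw² : .{{_ : ℤ.NonZero m}} → r * p ≡ sumSq w₁ w₂ w₃ w₄
    rp≡Σw² = ℤₚ.*-cancelˡ-≡ m _ _ (ℤₚ.*-cancelˡ-≡ m _ _ (begin
      m * (m * (r * p))                               ≡⟨ regroup m r p ⟩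
      (m * p) * (m * r)                               ≡⟨ cong₂ _*_ mp≡Σx² mr≡Σy² ⟩
      sumSq x₁ x₂ x₃ x₄ * sumSq y₁ y₂ y₃ y₄           ≡⟨ euler-identity x₁ x₂ x₃ x₄ y₁ y₂ y₃ y₄ ⟩
      sumSq z₁ z₂ z₃ z₄                               ≡⟨ cong₂ _+_ (cong₂ _+_ (cong₂ _+_ (sq z₁≡) (sq z₂≡)) (sq z₃≡)) (sq z₄≡) ⟩
      sumSq (m * w₁) (m * w₂) (m * w₃) (m * w₄)       ≡⟨ factor m w₁ w₂ w₃ w₄ ⟩
      m * (m * sumSq w₁ w₂ w₃ w₄)                     ∎))
      where
      open ≡-Reasoning
      z₁ = x₁ * y₁ + x₂ * y₂ + x₃ * y₃ + x₄ * y₄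
      z₂ = x₁ * y₂ - x₂ * y₁ + x₃ * y₄ - x₄ * y₃
      z₃ = x₁ * y₃ - x₃ * y₁ + x₄ * y₂ - x₂ * y₄
      z₄ = x₁ * y₄ - x₄ * y₁ + x₂ * y₃ - x₃ * y₂
      sq : ∀ {a b} → a ≡ b → a * a ≡ b * b
      sq e = cong₂ _*_ e e
      regroup : ∀ m r p → m * (m * (r * p)) ≡ (m * p) * (m * r)
      regroup = solve-∀
      factor : ∀ m a b c d → (m * a) * (m * a) + (m * b) * (m * b) + (m * c) * (m * c) + (m * d) * (m * d)
                           ≡ m * (m * (a * a + b * b + c * c + d * d))
      factor = solve-∀
      dot : ∀ m x₁ x₂ x₃ x₄ k₁ k₂ k₃ k₄ →
        x₁ * (x₁ - m * k₁) + x₂ * (x₂ - m * k₂) + x₃ * (x₃ - m * k₃) + x₄ * (x₄ - m * k₄) ≡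
        x₁ * x₁ + x₂ * x₂ + x₃ * x₃ + x₄ * x₄ - m * (x₁ * k₁ + x₂ * k₂ + x₃ * k₃ + x₄ * k₄)
      dot = solve-∀
      distrib : ∀ m p s → m * p - m * s ≡ m * (p - s)
      distrib = solve-∀
      cross : ∀ m a b c d k l i j →
        a * (b - m * l) - b * (a - m * k) + c * (d - m * j) - d * (c - m * i) ≡ m * (b * k - a * l + d * i - c * j)
      cross = solve-∀
      z₁≡ : z₁ ≡ m * w₁
      z₁≡ = trans (dot m x₁ x₂ x₃ x₄ k₁ k₂ k₃ k₄)
        (trans (cong (_- m * (x₁ * k₁ + x₂ * k₂ + x₃ * k₃ + x₄ * k₄)) (sym mp≡Σx²))
          (distrib m p (x₁ * k₁ + x₂ * k₂ + x₃ * k₃ + x₄ * k₄)))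
      z₂≡ : z₂ ≡ m * w₂
      z₂≡ = cross m x₁ x₂ x₃ x₄ k₁ k₂ k₃ k₄
      z₃≡ : z₃ ≡ m * w₃
      z₃≡ = cross m x₁ x₃ x₄ x₂ k₁ k₃ k₄ k₂
      z₄≡ : z₄ ≡ m * w₄
      z₄≡ = cross m x₁ x₄ x₂ x₃ k₁ k₄ k₂ k₃

nonNegative-factor : ∀ m .{{_ : NonZero m}} r {s} → + m * r ≡ + s → ∃ λ t → r ≡ + t
nonNegative-factor m       (+ t)    _  = t , refl
nonNegative-factor (suc m) -[1+ t ] ()

-- Strong induction on the multiplier: outside the extremal cases `r` is a smaller positive
-- multiplier than `m`.
prime-descent : ∀ {p} → Prime p → ∀ m → 1 ℕ.≤ m → m ℕ.< p →
  IsSumOfFourSquares (+ m * + p) → IsSumOfFourSquares (+ p)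
prime-descent {p} p-prime = <-rec _ step
  where
  step : ∀ m → (∀ {j} → j ℕ.< m → 1 ℕ.≤ j → j ℕ.< p → IsSumOfFourSquares (+ j * + p) → IsSumOfFourSquares (+ p)) →
         1 ℕ.≤ m → m ℕ.< p → IsSumOfFourSquares (+ m * + p) → IsSumOfFourSquares (+ p)
  step 1 _ _ _ s = subst IsSumOfFourSquares (ℤₚ.*-identityˡ (+ p)) s
  step m@(suc (suc _)) rec _ m<p (x₁ , x₂ , x₃ , x₄ , eq)
    with k₁ , b₁ ← centred-residue m x₁ | k₂ , b₂ ← centred-residue m x₂
       | k₃ , b₃ ← centred-residue m x₃ | k₄ , b₄ ← centred-residue m x₄
    with R , r≡R ← nonNegative-factor m (Descent.r (+ m) x₁ x₂ x₃ x₄ k₁ k₂ k₃ k₄ (+ p))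
           (trans (Descent.mr≡Σy² (+ m) x₁ x₂ x₃ x₄ k₁ k₂ k₃ k₄ (+ p) eq)
             (sumSq-abs (x₁ - + m * k₁) (x₂ - + m * k₂) (x₃ - + m * k₃) (x₄ - + m * k₄)))
    = conclude (squares-extremal m R b₁ b₂ b₃ b₄ Σ≡4mR)
    where
    open Descent (+ m) x₁ x₂ x₃ x₄ k₁ k₂ k₃ k₄ (+ p)
    scale : ∀ a b c d → (+ 2 * a) * (+ 2 * a) + (+ 2 * b) * (+ 2 * b) + (+ 2 * c) * (+ 2 * c) + (+ 2 * d) * (+ 2 * d)
                      ≡ + 4 * (a * a + b * b + c * c + d * d)
    scale = solve-∀
    Σ≡4mR : _ ≡ 4 ℕ.* (m ℕ.* R)
    Σ≡4mR = ℤₚ.+-injective (begin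
      + _                                               ≡⟨ sym (sumSq-abs (+ 2 * y₁) (+ 2 * y₂) (+ 2 * y₃) (+ 2 * y₄)) ⟩
      sumSq (+ 2 * y₁) (+ 2 * y₂) (+ 2 * y₃) (+ 2 * y₄) ≡⟨ scale y₁ y₂ y₃ y₄ ⟩
      + 4 * sumSq y₁ y₂ y₃ y₄                           ≡⟨ cong (+ 4 *_) (sym (mr≡Σy² eq)) ⟩
      + 4 * (+ m * r)                                   ≡⟨ cong (λ t → + 4 * (+ m * t)) r≡R ⟩
      + 4 * (+ m * + R)                                 ≡⟨ cong (+ 4 *_) (sym (ℤₚ.pos-* m R)) ⟩
      + 4 * + (m ℕ.* R)                                 ≡⟨ sym (ℤₚ.pos-* 4 (m ℕ.* R)) ⟩
      + (4 ℕ.* (m ℕ.* R))                               ∎)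
      where open ≡-Reasoning
    conclude : (1 ℕ.≤ R × R ℕ.< m) ⊎
      (m ℕᵈ.∣ R × m ℕᵈ.∣ ∣ + 2 * y₁ ∣ × m ℕᵈ.∣ ∣ + 2 * y₂ ∣ × m ℕᵈ.∣ ∣ + 2 * y₃ ∣ × m ℕᵈ.∣ ∣ + 2 * y₄ ∣) →
      IsSumOfFourSquares (+ p)
    conclude (inj₁ (1≤R , R<m)) = rec R<m 1≤R (ℕₚ.<-trans R<m m<p)
      (w₁ , w₂ , w₃ , w₄ , trans (cong (_* + p) (sym r≡R)) (rp≡Σw² eq))
    -- In the extremal cases every term of `p-expansion` is a multiple of `m`, hence so is `p`,
    -- which is absurd for 1 < m < p.
    conclude (inj₂ (m∣R , d₁ , d₂ , d₃ , d₄)) = ⊥-elim (m∤p (∣⇒∣ᵤ m∣p))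
      where
      m∣r : + m ℤᵈ.∣ r
      m∣r = subst (+ m ℤᵈ.∣_) (sym r≡R) (∣ᵤ⇒∣ m∣R)
      m∣p : + m ℤᵈ.∣ + p
      m∣p = subst (+ m ℤᵈ.∣_) (sym p-expansion)
        (ℤᵈ.∣m∣n⇒∣m+n
          (ℤᵈ.∣m∣n⇒∣m+n m∣r
            (ℤᵈ.∣m∣n⇒∣m+n
              (ℤᵈ.∣m∣n⇒∣m+n
                (ℤᵈ.∣m∣n⇒∣m+n (ℤᵈ.∣n⇒∣m*n k₁ (∣ᵤ⇒∣ d₁)) (ℤᵈ.∣n⇒∣m*n k₂ (∣ᵤ⇒∣ d₂)))
                (ℤᵈ.∣n⇒∣m*n k₃ (∣ᵤ⇒∣ d₃)))
              (ℤᵈ.∣n⇒∣m*n k₄ (∣ᵤ⇒∣ d₄))))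
          (ℤᵈ.∣n⇒∣m*n (sumSq k₁ k₂ k₃ k₄) ℤᵈ.∣-refl))
      m∤p : ¬ m ℕᵈ.∣ p
      m∤p d with prime⇒irreducible p-prime d
      ... | inj₁ ()
      ... | inj₂ m≡p = ℕₚ.<⇒≢ m<p m≡p

-- Minus one as a sum of two squares modulo an odd prime

%-≡⇒∣- : ∀ x y p .{{_ : NonZero p}} → x ℕ.% p ≡ y ℕ.% p → + p ℤᵈ.∣ + x - + y
%-≡⇒∣- x y p eq = ℤᵈ.divides (+ (x ℕ./ p) - + (y ℕ./ p)) (begin
  + x - + y
    ≡⟨ cong₂ _-_ (expand x) (trans (expand y) (cong (λ r → + r + + (y ℕ./ p) * + p) (sym eq))) ⟩
  + (x ℕ.% p) + + (x ℕ./ p) * + p - (+ (x ℕ.% p) + + (y ℕ./ p) * + p)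
    ≡⟨ lem (+ (x ℕ.% p)) (+ (x ℕ./ p)) (+ (y ℕ./ p)) (+ p) ⟩
  (+ (x ℕ./ p) - + (y ℕ./ p)) * + p ∎)
  where
  open ≡-Reasoning
  expand : ∀ x → + x ≡ + (x ℕ.% p) + + (x ℕ./ p) * + p
  expand x = trans (cong +_ (ℕᵐ.m≡m%n+[m/n]*n x p)) (cong (λ t → + (x ℕ.% p) + t) (ℤₚ.pos-* (x ℕ./ p) p))
  lem : ∀ r q q′ p → r + q * p - (r + q′ * p) ≡ (q - q′) * p
  lem = solve-∀

module MinusOne (h : ℕ) (1≤h : 1 ℕ.≤ h) (p-prime : Prime (suc (2 ℕ.* h))) where

  p : ℕ
  p = suc (2 ℕ.* h)

  p∣n<p⇒n≡0 : ∀ {n} → p ℕᵈ.∣ n → n ℕ.< p → n ≡ 0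
  p∣n<p⇒n≡0 {zero}  _   _   = refl
  p∣n<p⇒n≡0 {suc n} p∣n n<p = contradiction p∣n (ℕᵈ.>⇒∤ n<p)

  difference-of-squares : ∀ a b → a * a - b * b ≡ (a - b) * (a + b)
  difference-of-squares = solve-∀

  -- The prime divides `a - b` or `a + b`. Both have absolute value at most 2h, less than `p`, so
  -- the one divided is 0.
  square-injective : ∀ {a b} → a ℕ.≤ h → b ℕ.≤ h → + p ℤᵈ.∣ + a * + a - + b * + b → a ≡ b
  square-injective {a} {b} a≤h b≤h d with euclidsLemma ∣ + a - + b ∣ (a ℕ.+ b) p-prime
      (subst (p ℕᵈ.∣_) (ℤₚ.abs-* (+ a - + b) (+ a + + b)) (∣⇒∣ᵤ (subst (+ p ℤᵈ.∣_) (difference-of-squares (+ a) (+ b)) d)))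
  ... | inj₁ p∣a-b = ℤₚ.+-injective (ℤₚ.i-j≡0⇒i≡j (+ a) (+ b) (ℤₚ.∣i∣≡0⇒i≡0 (p∣n<p⇒n≡0 p∣a-b ∣a-b∣<p)))
    where
    ∣a-b∣<p : ∣ + a - + b ∣ ℕ.< p
    ∣a-b∣<p = s≤s (ℕₚ.≤-trans (ℤₚ.∣i-j∣≤∣i∣+∣j∣ (+ a) (+ b))
      (ℕₚ.+-mono-≤ a≤h (ℕₚ.≤-trans b≤h (ℕₚ.m≤m+n h 0))))
  ... | inj₂ p∣a+b with p∣n<p⇒n≡0 p∣a+b (s≤s (ℕₚ.+-mono-≤ a≤h (ℕₚ.≤-trans b≤h (ℕₚ.m≤m+n h 0))))
  ...   | a+b≡0 = trans (ℕₚ.m+n≡0⇒m≡0 a a+b≡0) (sym (ℕₚ.m+n≡0⇒n≡0 a a+b≡0))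

  -- As 2h ≡ -1 (mod p), the second summand gives the residues of -(b² + 1).
  value : Fin (suc h) ⊎ Fin (suc h) → ℕ
  value (inj₁ a) = toℕ a ℕ.* toℕ a
  value (inj₂ b) = 2 ℕ.* h ℕ.* (toℕ b ℕ.* toℕ b ℕ.+ 1)

  residue : Fin (suc h) ⊎ Fin (suc h) → Fin p
  residue s = fromℕ< (ℕᵐ.m%n<n (value s) p)

  ≤h : (a : Fin (suc h)) → toℕ a ℕ.≤ h
  ≤h = Finₚ.toℕ≤pred[n]

  pos-square : ∀ a → + (a ℕ.* a) ≡ + a * + a
  pos-square a = ℤₚ.pos-* a a

  pos-p : + p ≡ + 2 * + h + 1ℤ
  pos-p = trans (cong +_ (ℕₚ.+-comm 1 (2 ℕ.* h))) (cong (_+ 1ℤ) (ℤₚ.pos-* 2 h))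

  pos-value₂ : ∀ b → + (2 ℕ.* h ℕ.* (b ℕ.* b ℕ.+ 1)) ≡ + 2 * + h * (+ b * + b + 1ℤ)
  pos-value₂ b = trans (ℤₚ.pos-* (2 ℕ.* h) (b ℕ.* b ℕ.+ 1)) (cong₂ _*_ (ℤₚ.pos-* 2 h) (cong (_+ 1ℤ) (pos-square b)))

  p∣p* : ∀ x → + p ℤᵈ.∣ (+ 2 * + h + 1ℤ) * x
  p∣p* x = ℤᵈ.∣m⇒∣m*n x (subst (+ p ℤᵈ.∣_) pos-p ℤᵈ.∣-refl)

  mixed : ∀ a b → + p ℤᵈ.∣ + a * + a - + 2 * + h * (+ b * + b + 1ℤ) → + p ℤᵈ.∣ + a * + a + + b * + b + 1ℤ
  mixed a b d = subst (+ p ℤᵈ.∣_) (lem (+ a) (+ b) (+ h)) (ℤᵈ.∣m∣n⇒∣m+n d (p∣p* (+ b * + b + 1ℤ)))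
    where
    lem : ∀ a b h → a * a - + 2 * h * (b * b + + 1) + (+ 2 * h + + 1) * (b * b + + 1) ≡ a * a + b * b + + 1
    lem = solve-∀

  -- Within either half, distinct arguments have distinct residues by `square-injective`. A
  -- collision is therefore mixed and says that a² is congruent to -(b² + 1).
  collision : ∀ s t → s ≢ t → + p ℤᵈ.∣ + value s - + value t →
    ∃₂ λ a b → a ℕ.≤ h × b ℕ.≤ h × + p ℤᵈ.∣ + a * + a + + b * + b + 1ℤ
  collision (inj₁ a) (inj₁ b) s≢t d = contradiction (cong inj₁ (Finₚ.toℕ-injective
    (square-injective (≤h a) (≤h b) (subst (+ p ℤᵈ.∣_) (cong₂ _-_ (pos-square (toℕ a)) (pos-square (toℕ b))) d)))) s≢t
  collision (inj₂ a) (inj₂ b) s≢t d = contradiction (cong inj₂ (Finₚ.toℕ-injective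
    (square-injective (≤h a) (≤h b) (subst (+ p ℤᵈ.∣_) (lem (+ toℕ a) (+ toℕ b) (+ h))
      (ℤᵈ.∣m∣n⇒∣m-n (p∣p* (+ toℕ a * + toℕ a - + toℕ b * + toℕ b))
        (subst (+ p ℤᵈ.∣_) (cong₂ _-_ (pos-value₂ (toℕ a)) (pos-value₂ (toℕ b))) d)))))) s≢t
    where
    lem : ∀ a b h → (+ 2 * h + + 1) * (a * a - b * b) - (+ 2 * h * (a * a + + 1) - + 2 * h * (b * b + + 1)) ≡ a * a - b * b
    lem = solve-∀
  collision (inj₁ a) (inj₂ b) _ d = toℕ a , toℕ b , ≤h a , ≤h b ,
    mixed (toℕ a) (toℕ b) (subst (+ p ℤᵈ.∣_) (cong₂ _-_ (pos-square (toℕ a)) (pos-value₂ (toℕ b))) d)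
  collision (inj₂ b) (inj₁ a) _ d = toℕ a , toℕ b , ≤h a , ≤h b ,
    mixed (toℕ a) (toℕ b) (subst (+ p ℤᵈ.∣_) (trans (cong₂ (λ u v → - (u - v)) (pos-value₂ (toℕ b)) (pos-square (toℕ a)))
      (lem (+ 2 * + h * (+ toℕ b * + toℕ b + 1ℤ)) (+ toℕ a * + toℕ a))) (ℤᵈ.∣m⇒∣-m d))
    where
    lem : ∀ u v → - (u - v) ≡ v - u
    lem = solve-∀

  p<2h+2 : p ℕ.< suc h ℕ.+ suc h
  p<2h+2 = ℕₚ.≤-reflexive (lem h)
    where
    lem : ∀ h → suc (suc (2 ℕ.* h)) ≡ suc h ℕ.+ suc h
    lem = ℕ-Solver.solve-∀

  residue-≡⇒∣ : ∀ s t → residue s ≡ residue t → + p ℤᵈ.∣ + value s - + value t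
  residue-≡⇒∣ s t eq = %-≡⇒∣- (value s) (value t) p
    (Finₚ.fromℕ<-injective (value s ℕ.% p) (value t ℕ.% p) (ℕᵐ.m%n<n (value s) p) (ℕᵐ.m%n<n (value t) p) eq)

  splitAt-injective : ∀ {i j : Fin (suc h ℕ.+ suc h)} → splitAt (suc h) i ≡ splitAt (suc h) j → i ≡ j
  splitAt-injective {i} {j} e = trans (sym (Finₚ.join-splitAt (suc h) (suc h) i))
    (trans (cong (join (suc h) (suc h)) e) (Finₚ.join-splitAt (suc h) (suc h) j))

  -- Pigeonhole: 2h + 2 values fall into 2h + 1 residue classes.
  minusOne-sumOfTwoSquares : ∃₂ λ a b → a ℕ.≤ h × b ℕ.≤ h × + p ℤᵈ.∣ + a * + a + + b * + b + 1ℤ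
  minusOne-sumOfTwoSquares =
    let i , j , i<j , eq = Finₚ.pigeonhole p<2h+2 (residue ∘ splitAt (suc h))
        s = splitAt (suc h) i
        t = splitAt (suc h) j
    in collision s t (Finₚ.<⇒≢ i<j ∘ splitAt-injective) (residue-≡⇒∣ s t eq)

  -- Since `a` and `b` are at most `h`, the multiple is at most 2h² + 1, below (2h + 1)²; so the
  -- multiplier `q` is less than `p` and the descent can start.
  multiple⇒fourSquares : ∀ a b q → a ℕ.≤ h → b ℕ.≤ h → a ℕ.* a ℕ.+ b ℕ.* b ℕ.+ 1 ≡ q ℕ.* p →
    IsSumOfFourSquares (+ p)
  multiple⇒fourSquares a b q a≤h b≤h eq = prime-descent p-prime q 1≤q q<p
    (+ a , + b , 1ℤ , 0ℤ , trans (sym (ℤₚ.pos-* q p)) (trans (cong +_ (sym eq)) lift))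
    where
    lift : + (a ℕ.* a ℕ.+ b ℕ.* b ℕ.+ 1) ≡ + a * + a + + b * + b + 1ℤ * 1ℤ + 0ℤ * 0ℤ
    lift = trans (cong₂ (λ u v → u + v + 1ℤ) (pos-square a) (pos-square b)) (sym (ℤₚ.+-identityʳ _))
    1≤q : 1 ℕ.≤ q
    1≤q = ℕₚ.n≢0⇒n>0 λ q≡0 → contradiction
      (trans (ℕₚ.+-comm 1 (a ℕ.* a ℕ.+ b ℕ.* b)) (trans eq (cong (ℕ._* p) q≡0))) λ ()
    q<p : q ℕ.< p
    q<p = ℕₚ.*-cancelʳ-< p q p (begin-strict
      q ℕ.* p                              ≡⟨ eq ⟨
      a ℕ.* a ℕ.+ b ℕ.* b ℕ.+ 1            ≤⟨ ℕₚ.+-monoˡ-≤ 1 (ℕₚ.+-mono-≤ (ℕₚ.*-mono-≤ a≤h a≤h) (ℕₚ.*-mono-≤ b≤h b≤h)) ⟩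
      h ℕ.* h ℕ.+ h ℕ.* h ℕ.+ 1            <⟨ ℕₚ.m<m+n _ (ℕₚ.≤-trans 1≤h (ℕₚ.m≤m+n h _)) ⟩
      h ℕ.* h ℕ.+ h ℕ.* h ℕ.+ 1 ℕ.+ (h ℕ.+ (3 ℕ.* h ℕ.+ h ℕ.* h ℕ.+ h ℕ.* h)) ≡⟨ lem h ⟩
      p ℕ.* p                              ∎)
      where
      open ℕₚ.≤-Reasoning
      lem : ∀ h → h ℕ.* h ℕ.+ h ℕ.* h ℕ.+ 1 ℕ.+ (h ℕ.+ (3 ℕ.* h ℕ.+ h ℕ.* h ℕ.+ h ℕ.* h)) ≡ suc (2 ℕ.* h) ℕ.* suc (2 ℕ.* h)
      lem = ℕ-Solver.solve-∀

  prime-sumOfFourSquares : IsSumOfFourSquares (+ p)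
  prime-sumOfFourSquares =
    let a , b , a≤h , b≤h , p∣Σ = minusOne-sumOfTwoSquares
        p∣∣Σ∣ = ∣⇒∣ᵤ p∣Σ
    in multiple⇒fourSquares a b (ℕᵈ.quotient p∣∣Σ∣) a≤h b≤h
         (trans (cong ∣_∣ (cong₂ (λ u v → u + v + 1ℤ) (pos-square a) (pos-square b))) (ℕᵈ._∣_.equality p∣∣Σ∣))

-- From odd primes to all natural numbers

parity : ∀ n → ∃ λ h → n ≡ 2 ℕ.* h ⊎ n ≡ suc (2 ℕ.* h)
parity zero = 0 , inj₁ refl
parity (suc n) with parity n
... | h , inj₁ e = h , inj₂ (cong suc e)
... | h , inj₂ e = suc h , inj₁ (trans (cong suc e) (sym (ℕₚ.*-suc 2 h)))

prime⇒fourSquares : ∀ {p} → Prime p → IsSumOfFourSquares (+ p)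
prime⇒fourSquares {p} p-prime with parity p
... | zero  , inj₂ refl = contradiction p-prime ¬prime[1]
... | suc h , inj₂ refl = MinusOne.prime-sumOfFourSquares (suc h) (s≤s z≤n) p-prime
... | h     , inj₁ refl with prime⇒irreducible p-prime (ℕᵈ.m∣m*n h)
...   | inj₂ e = subst (IsSumOfFourSquares ∘ +_) e (1ℤ , 1ℤ , 0ℤ , 0ℤ , refl)

lagrange : ∀ n → IsSumOfFourSquares (+ n)
lagrange = <-rec _ step
  where
  step : ∀ n → (∀ {m} → m ℕ.< n → IsSumOfFourSquares (+ m)) → IsSumOfFourSquares (+ n)
  step 0 _ = 0ℤ , 0ℤ , 0ℤ , 0ℤ , refl
  step 1 _ = 1ℤ , 0ℤ , 0ℤ , 0ℤ , refl
  step n@(suc (suc _)) rec with prime? n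
  ... | yes n-prime = prime⇒fourSquares n-prime
  ... | no  n-composite with ¬prime⇒composite n-composite
  ...   | hasNonTrivialDivisor {d} d<n d∣n =
    subst IsSumOfFourSquares (trans (sym (ℤₚ.pos-* (ℕᵈ.quotient d∣n) d)) (cong +_ (sym (ℕᵈ._∣_.equality d∣n))))
      (fourSquares-* (rec (ℕᵈ.quotient-< d∣n)) (rec d<n))

-- Pronic numbers and reflections

pronic : ℤ → ℤ
pronic a = a * (a + 1ℤ)

:pronic : ∀ {n} → Polynomial n → Polynomial n
:pronic a = a :* (a :+ con 1ℤ)

pronic-≡0 : ∀ a → pronic a ≡ 0ℤ → a ≡ 0ℤ ⊎ a ≡ -1ℤ
pronic-≡0 a eq with ℤₚ.i*j≡0⇒i≡0∨j≡0 a eq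
... | inj₁ a≡0   = inj₁ a≡0
... | inj₂ a+1≡0 = inj₂ (trans (solve 1 (λ a → a := a :+ con 1ℤ :+ con -1ℤ) refl a) (cong (_+ -1ℤ) a+1≡0))

i≤∣i∣ : ∀ i → i ℤ.≤ + ∣ i ∣
i≤∣i∣ (+ n)    = ℤₚ.≤-refl
i≤∣i∣ -[1+ n ] = ℤ.-≤+

pronic-bound : ∀ a {m} → ∣ a ∣ ℕ.≤ m → pronic a ℤ.≤ + (m ℕ.* m ℕ.+ m)
pronic-bound a {m} ∣a∣≤m = begin
  a * (a + 1ℤ)                   ≡⟨ solve 1 (λ a → a :* (a :+ con 1ℤ) := a :* a :+ a) refl a ⟩
  a * a + a                      ≤⟨ ℤₚ.+-mono-≤ (ℤₚ.≤-reflexive (square-abs a)) (i≤∣i∣ a) ⟩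
  + (∣ a ∣ ℕ.* ∣ a ∣ ℕ.+ ∣ a ∣)  ≤⟨ ℤ.+≤+ (ℕₚ.+-mono-≤ (ℕₚ.*-mono-≤ ∣a∣≤m ∣a∣≤m) ∣a∣≤m) ⟩
  + (m ℕ.* m ℕ.+ m)              ∎
  where open ℤₚ.≤-Reasoning

pronic-3p-bound : ∀ p {m} → ∣ p ∣ ℕ.≤ m → pronic (+ 3 * p) ℤ.≤ + (3 ℕ.* m ℕ.* (3 ℕ.* m) ℕ.+ 3 ℕ.* m)
pronic-3p-bound p {m} ∣p∣≤m =
  pronic-bound (+ 3 * p) (subst (ℕ._≤ 3 ℕ.* m) (sym (ℤₚ.abs-* (+ 3) p)) (ℕₚ.*-monoʳ-≤ 3 ∣p∣≤m))

pronic-3p+1-bound : ∀ p {m} → ∣ p ∣ ℕ.≤ m →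
  pronic (+ 3 * p + 1ℤ) ℤ.≤ + ((3 ℕ.* m ℕ.+ 1) ℕ.* (3 ℕ.* m ℕ.+ 1) ℕ.+ (3 ℕ.* m ℕ.+ 1))
pronic-3p+1-bound p {m} ∣p∣≤m = pronic-bound (+ 3 * p + 1ℤ) (ℕₚ.≤-trans (ℤₚ.∣i+j∣≤∣i∣+∣j∣ (+ 3 * p) 1ℤ)
  (ℕₚ.+-monoˡ-≤ 1 (subst (ℕ._≤ 3 ℕ.* m) (sym (ℤₚ.abs-* (+ 3) p)) (ℕₚ.*-monoʳ-≤ 3 ∣p∣≤m))))

data Class (a : ℤ) : Set where
  3p   : ∀ p → pronic a ≡ pronic (+ 3 * p) → Class a
  3p+1 : ∀ p → pronic a ≡ pronic (+ 3 * p + 1ℤ) → Class a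

-- pronic is invariant under a ↦ -1 - a, which exchanges the residues 0 and 2 modulo 3.
classify : ∀ a → Class a
classify a with a %ℕ 3 | n%ℕd<d a 3 | a /ℕ 3 | a≡a%ℕn+[a/ℕn]*n a 3
... | 0 | _ | q | eq = 3p q (trans (cong pronic eq)
  (solve 1 (λ q → :pronic (con 0ℤ :+ q :* con (+ 3)) := :pronic (con (+ 3) :* q)) refl q))
... | 1 | _ | q | eq = 3p+1 q (trans (cong pronic eq)
  (solve 1 (λ q → :pronic (con 1ℤ :+ q :* con (+ 3)) := :pronic (con (+ 3) :* q :+ con 1ℤ)) refl q))
... | 2 | _ | q | eq = 3p (-1ℤ - q) (trans (cong pronic eq)
  (solve 1 (λ q → :pronic (con (+ 2) :+ q :* con (+ 3)) := :pronic (con (+ 3) :* (con -1ℤ :- q))) refl q))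
... | suc (suc (suc _)) | s≤s (s≤s (s≤s ())) | _ | _

-- The indices range over ℤ, but their pronic numbers are never negative, so nonzero amounts to
-- positive.
IsSumOfPositive : ℤ → Set
IsSumOfPositive N = ∃₂ λ a b → ∃₂ λ c d →
  (pronic a ≢ 0ℤ × pronic b ≢ 0ℤ × pronic c ≢ 0ℤ × pronic d ≢ 0ℤ) ×
  pronic a + pronic b + pronic c + pronic d ≡ N

positive-or-zero : ∀ {N} a b c d → pronic a + pronic b + pronic c + pronic d ≡ N →
  IsSumOfPositive N ⊎ pronic a ≡ 0ℤ ⊎ pronic b ≡ 0ℤ ⊎ pronic c ≡ 0ℤ ⊎ pronic d ≡ 0ℤ
positive-or-zero a b c d eq with pronic a ℤ.≟ 0ℤ
... | yes a≡0 = inj₂ (inj₁ a≡0)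
... | no  a≢0 with pronic b ℤ.≟ 0ℤ
...   | yes b≡0 = inj₂ (inj₂ (inj₁ b≡0))
...   | no  b≢0 with pronic c ℤ.≟ 0ℤ
...     | yes c≡0 = inj₂ (inj₂ (inj₂ (inj₁ c≡0)))
...     | no  c≢0 with pronic d ℤ.≟ 0ℤ
...       | yes d≡0 = inj₂ (inj₂ (inj₂ (inj₂ d≡0)))
...       | no  d≢0 = inj₁ (a , b , c , d , (a≢0 , b≢0 , c≢0 , d≢0) , eq)

-- (a , b , e) stands for the affine form a p + b q - e and for its zero line.
Affine : Set
Affine = ℤ × ℤ × ℤ

⟦_⟧ : Affine → ℤ → ℤ → ℤ
⟦ a , b , e ⟧ p q = a * p + b * q - e

:⟦_⟧ : ∀ {n} → Affine → Polynomial n → Polynomial n → Polynomial n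
:⟦ a , b , e ⟧ p q = con a :* p :+ con b :* q :- con e

Triple : Set
Triple = Affine × Affine × Affine

:pronics : ∀ {n} → Triple → Polynomial n → Polynomial n → Polynomial n
:pronics (F , G , H) p q = :pronic (:⟦ F ⟧ p q) :+ :pronic (:⟦ G ⟧ p q) :+ :pronic (:⟦ H ⟧ p q)

pronics : Triple → ℤ → ℤ → ℤ
pronics (F , G , H) p q = pronic (⟦ F ⟧ p q) + pronic (⟦ G ⟧ p q) + pronic (⟦ H ⟧ p q)

On : Affine → ℤ → ℤ → Set
On (a , b , c) p q = a * p + b * q ≡ c

swap : Affine → Affine
swap (a , b , c) = b , a , c

On-swap : ∀ l {p q} → On l p q → On (swap l) q p
On-swap (a , b , c) {p} {q} e = trans (ℤₚ.+-comm (b * q) (a * p)) e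

-- As `pronic` vanishes at -1 too, each form has a second line to avoid: the one where it takes the
-- value -1.
shift : Affine → Affine
shift (a , b , e) = a , b , e - 1ℤ

lines : Triple → List Affine
lines (F , G , H) = F ∷ shift F ∷ G ∷ shift G ∷ H ∷ shift H ∷ []

Degenerate : Triple → ℤ → ℤ → Set
Degenerate t p q = ∃ λ l → l ∈ lines t × On l p q

pronic-⟦⟧-≡0 : ∀ F p q → pronic (⟦ F ⟧ p q) ≡ 0ℤ → On F p q ⊎ On (shift F) p q
pronic-⟦⟧-≡0 F@(a , b , e) p q eq with pronic-≡0 (⟦ F ⟧ p q) eq
... | inj₁ z = inj₁ (ℤₚ.i-j≡0⇒i≡j (a * p + b * q) e z)
... | inj₂ z = inj₂ (trans (solve 2 (λ s e → s := s :- e :+ e) refl (a * p + b * q) e)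
                    (trans (cong (_+ e) z) (ℤₚ.+-comm -1ℤ e)))

triple-cases : ∀ {N} t p q d → pronics t p q + pronic d ≡ N →
  IsSumOfPositive N ⊎ Degenerate t p q ⊎ pronic d ≡ 0ℤ
triple-cases (F , G , H) p q d eq with positive-or-zero (⟦ F ⟧ p q) (⟦ G ⟧ p q) (⟦ H ⟧ p q) d eq
... | inj₁ good = inj₁ good
... | inj₂ (inj₂ (inj₂ (inj₂ d≡0))) = inj₂ (inj₂ d≡0)
... | inj₂ (inj₁ z) with pronic-⟦⟧-≡0 F p q z
...   | inj₁ o = inj₂ (inj₁ (_ , here refl , o))
...   | inj₂ o = inj₂ (inj₁ (_ , there (here refl) , o))
triple-cases (F , G , H) p q d eq | inj₂ (inj₂ (inj₁ z)) with pronic-⟦⟧-≡0 G p q z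
...   | inj₁ o = inj₂ (inj₁ (_ , there (there (here refl)) , o))
...   | inj₂ o = inj₂ (inj₁ (_ , there (there (there (here refl))) , o))
triple-cases (F , G , H) p q d eq | inj₂ (inj₂ (inj₂ (inj₁ z))) with pronic-⟦⟧-≡0 H p q z
...   | inj₁ o = inj₂ (inj₁ (_ , there (there (there (there (here refl)))) , o))
...   | inj₂ o = inj₂ (inj₁ (_ , there (there (there (there (there (here refl))))) , o))

-- Bounding common points of lines by Cramer's rule

Bounding : ℕ → ℤ → ℤ → Set
Bounding B D E = 1 ℕ.≤ ∣ D ∣ × ∣ E ∣ ℕ.≤ B ℕ.* ∣ D ∣

bounding? : ∀ B D E → Dec (Bounding B D E)
bounding? B D E = (1 ℕ.≤? ∣ D ∣) ×-dec (∣ E ∣ ℕ.≤? B ℕ.* ∣ D ∣)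

-- Here `D` and `E` depend on line coefficients only, so a decision procedure run over finitely many
-- lines bounds all their common points.
bounding : ∀ B D E p → D * p ≡ E → Bounding B D E → ∣ p ∣ ℕ.≤ B
bounding B D E p eq (1≤∣D∣ , ∣E∣≤) = ℕₚ.*-cancelʳ-≤ (∣ p ∣) B (∣ D ∣) {{ℕ.>-nonZero 1≤∣D∣}}
  (subst (ℕ._≤ B ℕ.* ∣ D ∣) (trans (cong ∣_∣ (sym eq)) (trans (ℤₚ.abs-* D p) (ℕₚ.*-comm (∣ D ∣) (∣ p ∣)))) ∣E∣≤)

det₂ det₂ₑ : Affine → Affine → ℤ
det₂  (a₁ , b₁ , c₁) (a₂ , b₂ , c₂) = b₂ * a₁ - b₁ * a₂
det₂ₑ (a₁ , b₁ , c₁) (a₂ , b₂ , c₂) = b₂ * c₁ - b₁ * c₂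

cramer₂ : ∀ l m {p q} → On l p q → On m p q → det₂ l m * p ≡ det₂ₑ l m
cramer₂ (a₁ , b₁ , _) (a₂ , b₂ , _) {p} {q} refl refl =
  solve 6 (λ a₁ b₁ a₂ b₂ p q → (b₂ :* a₁ :- b₁ :* a₂) :* p
    := b₂ :* (a₁ :* p :+ b₁ :* q) :- b₁ :* (a₂ :* p :+ b₂ :* q)) refl a₁ b₁ a₂ b₂ p q

-- Up to a common sign, the determinant and the Cramer numerator for `p` of the system with `l` in
-- the unknowns (p, q), `m` in (p, r) and `n` in (q, r).
det₃ det₃ₑ : Affine → Affine → Affine → ℤ
det₃  (a₁ , b₁ , c₁) (a₂ , b₂ , c₂) (a₃ , b₃ , c₃) = a₃ * b₂ * a₁ + b₃ * b₁ * a₂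
det₃ₑ (a₁ , b₁ , c₁) (a₂ , b₂ , c₂) (a₃ , b₃ , c₃) = a₃ * b₂ * c₁ + b₃ * b₁ * c₂ - b₁ * b₂ * c₃

cramer₃ : ∀ l m n {p q r} → On l p q → On m p r → On n q r → det₃ l m n * p ≡ det₃ₑ l m n
cramer₃ (a₁ , b₁ , _) (a₂ , b₂ , _) (a₃ , b₃ , _) {p} {q} {r} refl refl refl =
  solve 9 (λ a₁ b₁ a₂ b₂ a₃ b₃ p q r → (a₃ :* b₂ :* a₁ :+ b₃ :* b₁ :* a₂) :* p
    := a₃ :* b₂ :* (a₁ :* p :+ b₁ :* q) :+ b₃ :* b₁ :* (a₂ :* p :+ b₂ :* r) :- b₁ :* b₂ :* (a₃ :* q :+ b₃ :* r))
    refl a₁ b₁ a₂ b₂ a₃ b₃ p q r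

-- 270 = 3 * pronic 9 is the worst case below: three indices 3 p with ∣ p ∣ ≤ 3.
SumOrSmall : ℤ → Set
SumOrSmall N = IsSumOfPositive N ⊎ N ℤ.≤ + 270

-- Sums of one and of two pronic numbers

pronic-≡0⇒small : ∀ a → pronic a ≡ 0ℤ → ∣ a ∣ ℕ.≤ 1
pronic-≡0⇒small a eq with pronic-≡0 a eq
... | inj₁ refl = z≤n
... | inj₂ refl = s≤s z≤n

pronic-[x-c]≡0⇒small : ∀ x c → pronic (x - c) ≡ 0ℤ → ∣ x ∣ ℕ.≤ 1 ℕ.+ ∣ c ∣
pronic-[x-c]≡0⇒small x c eq = begin
  ∣ x ∣               ≡⟨ cong ∣_∣ (solve 2 (λ x c → x := x :- c :+ c) refl x c) ⟩
  ∣ x - c + c ∣       ≤⟨ ℤₚ.∣i+j∣≤∣i∣+∣j∣ (x - c) c ⟩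
  ∣ x - c ∣ ℕ.+ ∣ c ∣ ≤⟨ ℕₚ.+-monoˡ-≤ (∣ c ∣) (pronic-≡0⇒small (x - c) eq) ⟩
  1 ℕ.+ ∣ c ∣         ∎
  where open ℕₚ.≤-Reasoning

∣2p∣≤2⇒∣p∣≤1 : ∀ p → ∣ + 2 * p ∣ ℕ.≤ 2 → ∣ p ∣ ℕ.≤ 1
∣2p∣≤2⇒∣p∣≤1 p le = ℕₚ.*-cancelˡ-≤ 2 (subst (ℕ._≤ 2) (ℤₚ.abs-* (+ 2) p) le)

-- The symmetry a ↦ -1 - a of `pronic` exchanges even and odd indices.
halve : ∀ a → ∃ λ k → pronic a ≡ pronic (+ 2 * k)
halve a with a %ℕ 2 | n%ℕd<d a 2 | a /ℕ 2 | a≡a%ℕn+[a/ℕn]*n a 2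
... | 0 | _ | q | eq = q , trans (cong pronic eq)
  (solve 1 (λ q → :pronic (con 0ℤ :+ q :* con (+ 2)) := :pronic (con (+ 2) :* q)) refl q)
... | 1 | _ | q | eq = -1ℤ - q , trans (cong pronic eq)
  (solve 1 (λ q → :pronic (con 1ℤ :+ q :* con (+ 2)) := :pronic (con (+ 2) :* (con -1ℤ :- q))) refl q)
... | suc (suc _) | s≤s (s≤s ()) | _ | _

-- A triangle of side 2k splits into three of side k and one of side k - 1. Equivalently, reflect
-- the odd vector (1 , 1 , 1 , 4k + 1) in (1 , 1 , 1 , 1). A part vanishes only for small `k`.
sumOrSmall₁ : ∀ {N} a → pronic a ≡ N → SumOrSmall N
sumOrSmall₁ a refl with halve a
... | k , eq = conclude (positive-or-zero k k k (k - 1ℤ) (trans identity (sym eq)))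
  where
  identity : pronic k + pronic k + pronic k + pronic (k - 1ℤ) ≡ pronic (+ 2 * k)
  identity = solve 1 (λ k → :pronic k :+ :pronic k :+ :pronic k :+ :pronic (k :- con 1ℤ) := :pronic (con (+ 2) :* k)) refl k
  small : ∣ k ∣ ℕ.≤ 2 → SumOrSmall (pronic a)
  small ∣k∣≤2 = inj₂ (subst (ℤ._≤ + 270) (sym eq) (ℤₚ.≤-trans
    (pronic-bound (+ 2 * k) {4} (subst (ℕ._≤ 4) (sym (ℤₚ.abs-* (+ 2) k)) (ℕₚ.*-monoʳ-≤ 2 ∣k∣≤2)))
    (from-yes (+ 20 ℤ.≤? + 270))))
  small₁ : pronic k ≡ 0ℤ → SumOrSmall (pronic a)
  small₁ z = small (ℕₚ.≤-trans (pronic-≡0⇒small k z) (s≤s z≤n))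
  conclude : _ → SumOrSmall (pronic a)
  conclude (inj₁ good)                         = inj₁ good
  conclude (inj₂ (inj₁ z))                     = small₁ z
  conclude (inj₂ (inj₂ (inj₁ z)))              = small₁ z
  conclude (inj₂ (inj₂ (inj₂ (inj₁ z))))       = small₁ z
  conclude (inj₂ (inj₂ (inj₂ (inj₂ z))))       = small (pronic-[x-c]≡0⇒small k 1ℤ z)

drop-zero : ∀ {N x y} → x + y ≡ N → y ≡ 0ℤ → x ≡ N
drop-zero {x = x} eq refl = trans (sym (ℤₚ.+-identityʳ x)) eq

-- Two zero indices and that of `b` are reflected in a vector of norm 3, giving three pronic numbers
-- with sum `pronic b`, while `c` stays. This fails for |p| ≤ 2 at most, whence 42, the pronic
-- number of 6; a vanishing `pronic c` leaves a single summand.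
sumOrSmall₂-bound : ∀ {N} b c → pronic b + pronic c ≡ N → SumOrSmall N ⊎ pronic b ℤ.≤ + 42
sumOrSmall₂-bound b c refl with classify b
... | 3p p eq = conclude (positive-or-zero (+ 2 * p) (+ 2 * p) (p - 1ℤ) c
    (cong (_+ pronic c) (trans identity (sym eq))))
  where
  identity : pronic (+ 2 * p) + pronic (+ 2 * p) + pronic (p - 1ℤ) ≡ pronic (+ 3 * p)
  identity = solve 1 (λ p → :pronic (con (+ 2) :* p) :+ :pronic (con (+ 2) :* p) :+ :pronic (p :- con 1ℤ)
    := :pronic (con (+ 3) :* p)) refl p
  small : ∣ p ∣ ℕ.≤ 2 → SumOrSmall (pronic b + pronic c) ⊎ pronic b ℤ.≤ + 42
  small ∣p∣≤2 = inj₂ (subst (ℤ._≤ + 42) (sym eq) (pronic-3p-bound p ∣p∣≤2))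
  small₂ : pronic (+ 2 * p) ≡ 0ℤ → SumOrSmall (pronic b + pronic c) ⊎ pronic b ℤ.≤ + 42
  small₂ z = small (ℕₚ.m≤n⇒m≤1+n (∣2p∣≤2⇒∣p∣≤1 p (ℕₚ.m≤n⇒m≤1+n (pronic-≡0⇒small (+ 2 * p) z))))
  conclude : _ → SumOrSmall (pronic b + pronic c) ⊎ pronic b ℤ.≤ + 42
  conclude (inj₁ good)                   = inj₁ (inj₁ good)
  conclude (inj₂ (inj₁ z))               = small₂ z
  conclude (inj₂ (inj₂ (inj₁ z)))        = small₂ z
  conclude (inj₂ (inj₂ (inj₂ (inj₁ z)))) = small (pronic-[x-c]≡0⇒small p 1ℤ z)
  conclude (inj₂ (inj₂ (inj₂ (inj₂ z)))) = inj₁ (sumOrSmall₁ b (drop-zero refl z))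
-- The index 2p + 1 is written as a subtraction to fit `pronic-[x-c]≡0⇒small`.
... | 3p+1 p eq = conclude (positive-or-zero (+ 2 * p) (+ 2 * p - -1ℤ) p c
    (cong (_+ pronic c) (trans identity (sym eq))))
  where
  identity : pronic (+ 2 * p) + pronic (+ 2 * p - -1ℤ) + pronic p ≡ pronic (+ 3 * p + 1ℤ)
  identity = solve 1 (λ p → :pronic (con (+ 2) :* p) :+ :pronic (con (+ 2) :* p :- con -1ℤ) :+ :pronic p
    := :pronic (con (+ 3) :* p :+ con 1ℤ)) refl p
  small : ∣ p ∣ ℕ.≤ 1 → SumOrSmall (pronic b + pronic c) ⊎ pronic b ℤ.≤ + 42
  small ∣p∣≤1 = inj₂ (subst (ℤ._≤ + 42) (sym eq) (ℤₚ.≤-trans (pronic-3p+1-bound p ∣p∣≤1) (from-yes (+ 20 ℤ.≤? + 42))))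
  conclude : _ → SumOrSmall (pronic b + pronic c) ⊎ pronic b ℤ.≤ + 42
  conclude (inj₁ good)                   = inj₁ (inj₁ good)
  conclude (inj₂ (inj₁ z))               = small (∣2p∣≤2⇒∣p∣≤1 p (ℕₚ.m≤n⇒m≤1+n (pronic-≡0⇒small (+ 2 * p) z)))
  conclude (inj₂ (inj₂ (inj₁ z)))        = small (∣2p∣≤2⇒∣p∣≤1 p (pronic-[x-c]≡0⇒small (+ 2 * p) -1ℤ z))
  conclude (inj₂ (inj₂ (inj₂ (inj₁ z)))) = small (pronic-≡0⇒small p z)
  conclude (inj₂ (inj₂ (inj₂ (inj₂ z)))) = inj₁ (sumOrSmall₁ b (drop-zero refl z))

sumOrSmall₂ : ∀ {N} b c → pronic b + pronic c ≡ N → SumOrSmall N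
sumOrSmall₂ b c eq with sumOrSmall₂-bound b c eq | sumOrSmall₂-bound c b (trans (ℤₚ.+-comm (pronic c) (pronic b)) eq)
... | inj₁ done | _ = done
... | inj₂ _ | inj₁ done = done
... | inj₂ b≤ | inj₂ c≤ = inj₂ (subst (ℤ._≤ + 270) eq (ℤₚ.≤-trans (ℤₚ.+-mono-≤ b≤ c≤) (from-yes (+ 84 ℤ.≤? + 270))))

-- These triples come from the reflection of ℤ⁴ in a vector (1 , ±1 , ±1 , 0) of norm 3, applied to
-- (1 , x , y , z) with pronic index (x - 1) / 2; it is integral when 1 ± x ± y ≡ 0 (mod 3).
reflection₀₀ reflection₁₀ reflection₁₀′ : Triple
reflection₀₀  = (- + 2 , - + 2 , 1ℤ) , (1ℤ , - + 2 , 1ℤ) , (- + 2 , 1ℤ , 1ℤ)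
reflection₁₀  = (- + 2 , + 2 , 1ℤ) , (1ℤ , + 2 , 0ℤ) , (- + 2 , -1ℤ , + 2)
reflection₁₀′ = (+ 2 , + 2 , -1ℤ) , (-1ℤ , + 2 , 1ℤ) , (+ 2 , -1ℤ , 0ℤ)

pronics-reflection₀₀ : ∀ p q → pronics reflection₀₀ p q ≡ pronic (+ 3 * p) + pronic (+ 3 * q)
pronics-reflection₀₀ = solve 2 (λ p q → :pronics reflection₀₀ p q := :pronic (con (+ 3) :* p) :+ :pronic (con (+ 3) :* q)) refl

pronics-reflection₁₀ : ∀ p q → pronics reflection₁₀ p q ≡ pronic (+ 3 * p + 1ℤ) + pronic (+ 3 * q)
pronics-reflection₁₀ = solve 2 (λ p q → :pronics reflection₁₀ p q := :pronic (con (+ 3) :* p :+ con 1ℤ) :+ :pronic (con (+ 3) :* q)) refl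

-- A mixed pair admits two reflections: its odd numbers are x = 6p + 3 and y = 6q + 1, so 1 + x - y
-- and 1 - x - y are both multiples of 3.
pronics-reflection₁₀′ : ∀ p q → pronics reflection₁₀′ p q ≡ pronic (+ 3 * p + 1ℤ) + pronic (+ 3 * q)
pronics-reflection₁₀′ = solve 2 (λ p q → :pronics reflection₁₀′ p q := :pronic (con (+ 3) :* p :+ con 1ℤ) :+ :pronic (con (+ 3) :* q)) refl

-- Bounds on the indices at which the reflections fail

Bounded₃ : Affine → Affine → Affine → Set
Bounded₃ l m n = Bounding 3 (det₃ l m n) (det₃ₑ l m n)

bounded₃? : ∀ l m n → Dec (Bounded₃ l m n)
bounded₃? l m n = bounding? 3 (det₃ l m n) (det₃ₑ l m n)

-- A finite check over all 6³ choices of lines. The three conditions concern one linear system, with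
-- `p`, `q` and `r` in turn as the unknown to be bounded; `swap` adapts the order of the
-- coordinates.
reflection₀₀-bounds : All (λ l → All (λ m → All (λ n →
  Bounded₃ l m n × Bounded₃ (swap l) n m × Bounded₃ (swap m) (swap n) l)
  (lines reflection₀₀)) (lines reflection₀₀)) (lines reflection₀₀)
reflection₀₀-bounds = from-yes (all? (λ l → all? (λ m → all? (λ n →
  bounded₃? l m n ×-dec bounded₃? (swap l) n m ×-dec bounded₃? (swap m) (swap n) l)
  (lines reflection₀₀)) (lines reflection₀₀)) (lines reflection₀₀))

Bounded₃-sound : ∀ l m n {p q r} → On l p q → On m p r → On n q r → Bounded₃ l m n → ∣ p ∣ ℕ.≤ 3
Bounded₃-sound l m n {p} ol om on = bounding 3 (det₃ l m n) (det₃ₑ l m n) p (cramer₃ l m n ol om on)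

degenerate₀₀-bounded : ∀ {p q r} → Degenerate reflection₀₀ p q → Degenerate reflection₀₀ p r → Degenerate reflection₀₀ q r →
  ∣ p ∣ ℕ.≤ 3 × ∣ q ∣ ℕ.≤ 3 × ∣ r ∣ ℕ.≤ 3
degenerate₀₀-bounded (l , l∈ , ol) (m , m∈ , om) (n , n∈ , on) =
  let bp , bq , br = All.lookup (All.lookup (All.lookup reflection₀₀-bounds l∈) m∈) n∈ in
  Bounded₃-sound l m n ol om on bp ,
  Bounded₃-sound (swap l) n m (On-swap l ol) on om bq ,
  Bounded₃-sound (swap m) (swap n) l (On-swap m om) (On-swap n on) ol br

Bounded₂ : ℕ → Affine → Affine → Set
Bounded₂ B l m = Bounding B (det₂ l m) (det₂ₑ l m)

bounded₂? : ∀ B l m → Dec (Bounded₂ B l m)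
bounded₂? B l m = bounding? B (det₂ l m) (det₂ₑ l m)

Bounded₂-sound : ∀ B l m {p q} → On l p q → On m p q → Bounded₂ B l m → ∣ p ∣ ℕ.≤ B
Bounded₂-sound B l m {p} ol om = bounding B (det₂ l m) (det₂ₑ l m) p (cramer₂ l m ol om)

-- Two reflections of the same pair give two lines in one plane. None of the 36 choices is parallel,
-- so each leaves a single point.
reflection₁₀-bounds : All (λ l → All (λ m → Bounded₂ 2 l m × Bounded₂ 1 (swap l) (swap m)) (lines reflection₁₀′)) (lines reflection₁₀)
reflection₁₀-bounds = from-yes (all? (λ l → all? (λ m →
  bounded₂? 2 l m ×-dec bounded₂? 1 (swap l) (swap m)) (lines reflection₁₀′)) (lines reflection₁₀))

degenerate₁₀-bounded : ∀ {p q} → Degenerate reflection₁₀ p q → Degenerate reflection₁₀′ p q → ∣ p ∣ ℕ.≤ 2 × ∣ q ∣ ℕ.≤ 1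
degenerate₁₀-bounded (l , l∈ , ol) (m , m∈ , om) =
  let bp , bq = All.lookup (All.lookup reflection₁₀-bounds l∈) m∈ in
  Bounded₂-sound 2 l m ol om bp ,
  Bounded₂-sound 1 (swap l) (swap m) (On-swap l ol) (On-swap m om) bq

-- On such a line b r = c - a q, so these inequalities bound `r` by 3 once |q| ≤ 1.
reflection₀₀-slopes : All (λ (a , b , c) → 1 ℕ.≤ ∣ b ∣ × ∣ c ∣ ℕ.+ ∣ a ∣ ℕ.≤ 3) (lines reflection₀₀)
reflection₀₀-slopes = from-yes (all? (λ (a , b , c) → (1 ℕ.≤? ∣ b ∣) ×-dec (∣ c ∣ ℕ.+ ∣ a ∣ ℕ.≤? 3)) (lines reflection₀₀))

degenerate₀₀-bounded′ : ∀ {q r} → Degenerate reflection₀₀ q r → ∣ q ∣ ℕ.≤ 1 → ∣ r ∣ ℕ.≤ 3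
degenerate₀₀-bounded′ {q} {r} ((a , b , c) , l∈ , ol) ∣q∣≤1 with 1≤∣b∣ , slope ← All.lookup reflection₀₀-slopes l∈ = begin
  ∣ r ∣                     ≤⟨ ℕₚ.m≤n*m (∣ r ∣) (∣ b ∣) {{ℕ.>-nonZero 1≤∣b∣}} ⟩
  ∣ b ∣ ℕ.* ∣ r ∣           ≡⟨ ℤₚ.abs-* b r ⟨
  ∣ b * r ∣                 ≡⟨ cong ∣_∣ (solve 2 (λ x y → y := (x :+ y) :- x) refl (a * q) (b * r)) ⟩
  ∣ a * q + b * r - a * q ∣ ≡⟨ cong (λ t → ∣ t - a * q ∣) ol ⟩
  ∣ c - a * q ∣             ≤⟨ ℤₚ.∣i-j∣≤∣i∣+∣j∣ c (a * q) ⟩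
  ∣ c ∣ ℕ.+ ∣ a * q ∣       ≡⟨ cong (∣ c ∣ ℕ.+_) (ℤₚ.abs-* a q) ⟩
  ∣ c ∣ ℕ.+ ∣ a ∣ ℕ.* ∣ q ∣ ≤⟨ ℕₚ.+-monoʳ-≤ (∣ c ∣) (ℕₚ.*-monoʳ-≤ (∣ a ∣) ∣q∣≤1) ⟩
  ∣ c ∣ ℕ.+ ∣ a ∣ ℕ.* 1     ≡⟨ cong (∣ c ∣ ℕ.+_) (ℕₚ.*-identityʳ (∣ a ∣)) ⟩
  ∣ c ∣ ℕ.+ ∣ a ∣           ≤⟨ slope ⟩
  3                         ∎
  where open ℕₚ.≤-Reasoning

-- The absent fourth summand has index 0 and supplies the entry 1 of the reflected vector: the
-- triple `t` replaces 0, `b`, `c`, and `d` is kept. If `pronic d` vanishes, two summands remain.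
reflect : ∀ {N} t b c d p q → pronics t p q ≡ pronic b + pronic c → pronic b + pronic c + pronic d ≡ N →
  SumOrSmall N ⊎ Degenerate t p q
reflect {N} t b c d p q same eq = conclude (triple-cases t p q d (trans (cong (_+ pronic d) same) eq))
  where
  conclude : IsSumOfPositive N ⊎ Degenerate t p q ⊎ pronic d ≡ 0ℤ → SumOrSmall N ⊎ Degenerate t p q
  conclude (inj₁ good)              = inj₁ (inj₁ good)
  conclude (inj₂ (inj₁ degenerate)) = inj₂ degenerate
  conclude (inj₂ (inj₂ d≡0))        = inj₁ (sumOrSmall₂ b c (drop-zero eq d≡0))

-- Sums of three and of four pronic numbers

swap₂₃ : ∀ {N} x y z → x + y + z ≡ N → x + z + y ≡ N
swap₂₃ x y z eq = trans (solve 3 (λ x y z → x :+ z :+ y := x :+ y :+ z) refl x y z) eq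

rotate : ∀ {N} x y z → x + y + z ≡ N → y + z + x ≡ N
rotate x y z eq = trans (solve 3 (λ x y z → y :+ z :+ x := x :+ y :+ z) refl x y z) eq

small₃ : ∀ {N} x y z {i j k} → x + y + z ≡ N → x ℤ.≤ + i → y ℤ.≤ + j → z ℤ.≤ + k → i ℕ.+ j ℕ.+ k ℕ.≤ 270 → SumOrSmall N
small₃ x y z refl x≤ y≤ z≤ le = inj₂ (ℤₚ.≤-trans (ℤₚ.+-mono-≤ (ℤₚ.+-mono-≤ x≤ y≤) z≤) (ℤ.+≤+ le))

-- Every pair admits `reflection₀₀`. If all three attempts fail, there is one line for each pair of
-- `p`, `q`, `r`, and these bound all three indices.
sumOrSmall₀₀₀ : ∀ {N} p q r → pronic (+ 3 * p) + pronic (+ 3 * q) + pronic (+ 3 * r) ≡ N → SumOrSmall N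
sumOrSmall₀₀₀ {N} p q r eq = conclude
  (reflect reflection₀₀ (+ 3 * p) (+ 3 * q) (+ 3 * r) p q (pronics-reflection₀₀ p q) eq)
  (reflect reflection₀₀ (+ 3 * p) (+ 3 * r) (+ 3 * q) p r (pronics-reflection₀₀ p r) (swap₂₃ x y z eq))
  (reflect reflection₀₀ (+ 3 * q) (+ 3 * r) (+ 3 * p) q r (pronics-reflection₀₀ q r) (rotate x y z eq))
  where
  x = pronic (+ 3 * p)
  y = pronic (+ 3 * q)
  z = pronic (+ 3 * r)
  conclude : SumOrSmall N ⊎ Degenerate reflection₀₀ p q → SumOrSmall N ⊎ Degenerate reflection₀₀ p r →
    SumOrSmall N ⊎ Degenerate reflection₀₀ q r → SumOrSmall N
  conclude (inj₁ done) _           _           = done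
  conclude _           (inj₁ done) _           = done
  conclude _           _           (inj₁ done) = done
  conclude (inj₂ dpq)  (inj₂ dpr)  (inj₂ dqr)  =
    let p≤ , q≤ , r≤ = degenerate₀₀-bounded dpq dpr dqr in
    small₃ x y z {90} {90} {90} eq (pronic-3p-bound p p≤) (pronic-3p-bound q q≤) (pronic-3p-bound r r≤) (from-yes (270 ℕ.≤? 270))

bound₁₀ : ∀ {N} p q d → pronic (+ 3 * p + 1ℤ) + pronic (+ 3 * q) + pronic d ≡ N →
  SumOrSmall N ⊎ ∣ p ∣ ℕ.≤ 2 × ∣ q ∣ ℕ.≤ 1
bound₁₀ {N} p q d eq = conclude
  (reflect reflection₁₀ (+ 3 * p + 1ℤ) (+ 3 * q) d p q (pronics-reflection₁₀ p q) eq)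
  (reflect reflection₁₀′ (+ 3 * p + 1ℤ) (+ 3 * q) d p q (pronics-reflection₁₀′ p q) eq)
  where
  conclude : SumOrSmall N ⊎ Degenerate reflection₁₀ p q → SumOrSmall N ⊎ Degenerate reflection₁₀′ p q →
    SumOrSmall N ⊎ ∣ p ∣ ℕ.≤ 2 × ∣ q ∣ ℕ.≤ 1
  conclude (inj₁ done) _           = inj₁ done
  conclude _           (inj₁ done) = inj₁ done
  conclude (inj₂ deg)  (inj₂ deg′) = inj₂ (degenerate₁₀-bounded deg deg′)

-- The mixed pair has already bounded `p` and `q`; reflecting the pair of multiples of 3 bounds `r`.
sumOrSmall₁₀₀ : ∀ {N} p q r → ∣ p ∣ ℕ.≤ 2 → ∣ q ∣ ℕ.≤ 1 →
  pronic (+ 3 * p + 1ℤ) + pronic (+ 3 * q) + pronic (+ 3 * r) ≡ N → SumOrSmall N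
sumOrSmall₁₀₀ {N} p q r p≤ q≤ eq = conclude
  (reflect reflection₀₀ (+ 3 * q) (+ 3 * r) (+ 3 * p + 1ℤ) q r (pronics-reflection₀₀ q r) (rotate x y z eq))
  where
  x = pronic (+ 3 * p + 1ℤ)
  y = pronic (+ 3 * q)
  z = pronic (+ 3 * r)
  conclude : SumOrSmall N ⊎ Degenerate reflection₀₀ q r → SumOrSmall N
  conclude (inj₁ done) = done
  -- 56, 12 and 90 are the pronic numbers of 7, 3 and 9.
  conclude (inj₂ deg)  = small₃ x y z {56} {12} {90} eq (pronic-3p+1-bound p p≤) (pronic-3p-bound q q≤)
    (pronic-3p-bound r (degenerate₀₀-bounded′ deg q≤)) (from-yes (158 ℕ.≤? 270))

sumOrSmall₁₀₁ : ∀ {N} p q r → ∣ p ∣ ℕ.≤ 2 → ∣ q ∣ ℕ.≤ 1 →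
  pronic (+ 3 * p + 1ℤ) + pronic (+ 3 * q) + pronic (+ 3 * r + 1ℤ) ≡ N → SumOrSmall N
-- The third and second indices again form a mixed pair, which bounds `r`.
sumOrSmall₁₀₁ {N} p q r p≤ q≤ eq = conclude (bound₁₀ r q (+ 3 * p + 1ℤ) (swap₂₃ z x y (rotate y z x (rotate x y z eq))))
  where
  x = pronic (+ 3 * p + 1ℤ)
  y = pronic (+ 3 * q)
  z = pronic (+ 3 * r + 1ℤ)
  conclude : SumOrSmall N ⊎ ∣ r ∣ ℕ.≤ 2 × ∣ q ∣ ℕ.≤ 1 → SumOrSmall N
  conclude (inj₁ done)     = done
  conclude (inj₂ (r≤ , _)) = small₃ x y z {56} {12} {56} eq (pronic-3p+1-bound p p≤) (pronic-3p-bound q q≤)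
    (pronic-3p+1-bound r r≤) (from-yes (124 ℕ.≤? 270))

sumOrSmall₁₀ : ∀ {N} p q d → pronic (+ 3 * p + 1ℤ) + pronic (+ 3 * q) + pronic d ≡ N → SumOrSmall N
sumOrSmall₁₀ {N} p q d eq = conclude (bound₁₀ p q d eq) (classify d)
  where
  replace : ∀ {z} → pronic d ≡ z → pronic (+ 3 * p + 1ℤ) + pronic (+ 3 * q) + z ≡ N
  replace refl = eq
  conclude : SumOrSmall N ⊎ ∣ p ∣ ℕ.≤ 2 × ∣ q ∣ ℕ.≤ 1 → Class d → SumOrSmall N
  conclude (inj₁ done)      _          = done
  conclude (inj₂ (p≤ , q≤)) (3p r e)   = sumOrSmall₁₀₀ p q r p≤ q≤ (replace e)
  conclude (inj₂ (p≤ , q≤)) (3p+1 r e) = sumOrSmall₁₀₁ p q r p≤ q≤ (replace e)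

positive-or-three : ∀ {N} a b c d → pronic a + pronic b + pronic c + pronic d ≡ N →
  IsSumOfPositive N ⊎ pronic b + pronic c + pronic d ≡ N ⊎ pronic a + pronic c + pronic d ≡ N
                    ⊎ pronic a + pronic b + pronic d ≡ N ⊎ pronic a + pronic b + pronic c ≡ N
positive-or-three {N} a b c d eq = conclude (positive-or-zero a b c d eq)
  where
  x = pronic a
  y = pronic b
  z = pronic c
  w = pronic d
  conclude : IsSumOfPositive N ⊎ x ≡ 0ℤ ⊎ y ≡ 0ℤ ⊎ z ≡ 0ℤ ⊎ w ≡ 0ℤ → _
  conclude (inj₁ good) = inj₁ good
  conclude (inj₂ (inj₁ e)) = inj₂ (inj₁
    (drop-zero (trans (solve 4 (λ x y z w → y :+ z :+ w :+ x := x :+ y :+ z :+ w) refl x y z w) eq) e))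
  conclude (inj₂ (inj₂ (inj₁ e))) = inj₂ (inj₂ (inj₁
    (drop-zero (trans (solve 4 (λ x y z w → x :+ z :+ w :+ y := x :+ y :+ z :+ w) refl x y z w) eq) e)))
  conclude (inj₂ (inj₂ (inj₂ (inj₁ e)))) = inj₂ (inj₂ (inj₂ (inj₁
    (drop-zero (trans (solve 4 (λ x y z w → x :+ y :+ w :+ z := x :+ y :+ z :+ w) refl x y z w) eq) e))))
  conclude (inj₂ (inj₂ (inj₂ (inj₂ e)))) = inj₂ (inj₂ (inj₂ (inj₂ (drop-zero eq e))))

-- The reflection in (1 , 1 , 1 , 1), which turns three indices of the form 3 p + 1 into multiples of 3.
sumOrSmall₁₁₁-odd : ∀ {N} k q r →
  pronic (+ 3 * (+ 2 * k + 1ℤ - q - r) + 1ℤ) + pronic (+ 3 * q + 1ℤ) + pronic (+ 3 * r + 1ℤ) ≡ N → SumOrSmall N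
sumOrSmall₁₁₁-odd {N} k q r eq = conclude (positive-or-three (+ 3 * a) (+ 3 * b) (+ 3 * c) (+ 3 * d) (trans identity eq))
  where
  a = k + 1ℤ
  b = k - q - r
  c = q - k - 1ℤ
  d = r - k - 1ℤ
  identity : pronic (+ 3 * a) + pronic (+ 3 * b) + pronic (+ 3 * c) + pronic (+ 3 * d) ≡
    pronic (+ 3 * (+ 2 * k + 1ℤ - q - r) + 1ℤ) + pronic (+ 3 * q + 1ℤ) + pronic (+ 3 * r + 1ℤ)
  identity = solve 3 (λ k q r →
    :pronic (con (+ 3) :* (k :+ con 1ℤ)) :+ :pronic (con (+ 3) :* (k :- q :- r))
      :+ :pronic (con (+ 3) :* (q :- k :- con 1ℤ)) :+ :pronic (con (+ 3) :* (r :- k :- con 1ℤ)) :=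
    :pronic (con (+ 3) :* (con (+ 2) :* k :+ con 1ℤ :- q :- r) :+ con 1ℤ)
      :+ :pronic (con (+ 3) :* q :+ con 1ℤ) :+ :pronic (con (+ 3) :* r :+ con 1ℤ)) refl k q r
  -- All four new indices are multiples of 3, so whichever of them fails, the other three fall under
  -- `sumOrSmall₀₀₀`.
  conclude : _ → SumOrSmall N
  conclude (inj₁ good)                   = inj₁ good
  conclude (inj₂ (inj₁ e))               = sumOrSmall₀₀₀ b c d e
  conclude (inj₂ (inj₂ (inj₁ e)))        = sumOrSmall₀₀₀ a c d e
  conclude (inj₂ (inj₂ (inj₂ (inj₁ e)))) = sumOrSmall₀₀₀ a b d e
  conclude (inj₂ (inj₂ (inj₂ (inj₂ e)))) = sumOrSmall₀₀₀ a b c e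

-- Reflection in (1 , 1 , 1 , 1) keeps the entries odd only if `p + q + r` is odd. The map p ↦ -1 -
-- p preserves `pronic (+ 3 * p + 1ℤ)` and flips this parity.
odd-sum : ∀ p q r → ∃ λ k → pronic (+ 3 * p + 1ℤ) ≡ pronic (+ 3 * (+ 2 * k + 1ℤ - q - r) + 1ℤ)
odd-sum p q r with (p + q + r) %ℕ 2 | n%ℕd<d (p + q + r) 2 | (p + q + r) /ℕ 2 | a≡a%ℕn+[a/ℕn]*n (p + q + r) 2
... | 0 | _ | k | eq = q + r - k - 1ℤ , trans
  (cong (λ s → pronic (+ 3 * s + 1ℤ)) (trans (solve 3 (λ p q r → p := p :+ q :+ r :- q :- r) refl p q r) (cong (λ s → s - q - r) eq)))
  (solve 3 (λ k q r → :pronic (con (+ 3) :* (con 0ℤ :+ k :* con (+ 2) :- q :- r) :+ con 1ℤ) :=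
    :pronic (con (+ 3) :* (con (+ 2) :* (q :+ r :- k :- con 1ℤ) :+ con 1ℤ :- q :- r) :+ con 1ℤ)) refl k q r)
... | 1 | _ | k | eq = k , trans
  (cong (λ s → pronic (+ 3 * s + 1ℤ)) (trans (solve 3 (λ p q r → p := p :+ q :+ r :- q :- r) refl p q r) (cong (λ s → s - q - r) eq)))
  (solve 3 (λ k q r → :pronic (con (+ 3) :* (con 1ℤ :+ k :* con (+ 2) :- q :- r) :+ con 1ℤ) :=
    :pronic (con (+ 3) :* (con (+ 2) :* k :+ con 1ℤ :- q :- r) :+ con 1ℤ)) refl k q r)
... | suc (suc _) | s≤s (s≤s ()) | _ | _

sumOrSmall₁₁₁ : ∀ {N} p q r → pronic (+ 3 * p + 1ℤ) + pronic (+ 3 * q + 1ℤ) + pronic (+ 3 * r + 1ℤ) ≡ N → SumOrSmall N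
sumOrSmall₁₁₁ p q r eq =
  let k , e = odd-sum p q r in
  sumOrSmall₁₁₁-odd k q r (trans (cong (λ x → x + pronic (+ 3 * q + 1ℤ) + pronic (+ 3 * r + 1ℤ)) (sym e)) eq)

-- Unless all three indices lie in one class, some two of them form a mixed pair, which is moved to
-- the front.
sumOrSmall₃ : ∀ {N} b c d → pronic b + pronic c + pronic d ≡ N → SumOrSmall N
sumOrSmall₃ {N} b c d eq = conclude (classify b) (classify c) (classify d)
  where
  x = pronic b
  y = pronic c
  z = pronic d
  replace : ∀ {x y z x′ y′ z′} → x ≡ x′ → y ≡ y′ → z ≡ z′ → x + y + z ≡ N → x′ + y′ + z′ ≡ N
  replace refl refl refl e = e
  conclude : Class b → Class c → Class d → SumOrSmall N
  conclude (3p p e)   (3p q f)   (3p r g)   = sumOrSmall₀₀₀ p q r (replace e f g eq)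
  conclude (3p+1 p e) (3p+1 q f) (3p+1 r g) = sumOrSmall₁₁₁ p q r (replace e f g eq)
  conclude (3p+1 p e) (3p q f)   _          = sumOrSmall₁₀ p q d (replace e f refl eq)
  conclude (3p+1 p e) _          (3p r g)   = sumOrSmall₁₀ p r c (replace e g refl (swap₂₃ x y z eq))
  conclude (3p p e)   (3p+1 q f) _          = sumOrSmall₁₀ q p d (replace f e refl (swap₂₃ y z x (rotate x y z eq)))
  conclude (3p p e)   _          (3p+1 r g) = sumOrSmall₁₀ r p c (replace g e refl (rotate y z x (rotate x y z eq)))

sumOrSmall₄ : ∀ {N} a b c d → pronic a + pronic b + pronic c + pronic d ≡ N → SumOrSmall N
sumOrSmall₄ {N} a b c d eq = conclude (positive-or-three a b c d eq)
  where
  conclude : _ → SumOrSmall N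
  conclude (inj₁ good)                   = inj₁ good
  conclude (inj₂ (inj₁ e))               = sumOrSmall₃ b c d e
  conclude (inj₂ (inj₂ (inj₁ e)))        = sumOrSmall₃ a c d e
  conclude (inj₂ (inj₂ (inj₂ (inj₁ e)))) = sumOrSmall₃ a b d e
  conclude (inj₂ (inj₂ (inj₂ (inj₂ e)))) = sumOrSmall₃ a b c e

-- If a² + b² + c² + d² = 2 n + 1 then s = a + b + c + d is odd, and the four odd numbers
-- s, s - 2 (c + d), s - 2 (b + d), s - 2 (b + c) have squares summing to 4 (2 n + 1).
fourPronics : ∀ n → ∃₂ λ a b → ∃₂ λ c d → pronic a + pronic b + pronic c + pronic d ≡ + (2 ℕ.* n)
fourPronics n = from-squares (lagrange (suc (2 ℕ.* n)))
  where
  from-squares : IsSumOfFourSquares (+ suc (2 ℕ.* n)) →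
    ∃₂ λ a b → ∃₂ λ c d → pronic a + pronic b + pronic c + pronic d ≡ + (2 ℕ.* n)
  from-squares (a , b , c , d , eq)
    with (a + b + c + d) %ℕ 2 | n%ℕd<d (a + b + c + d) 2 | (a + b + c + d) /ℕ 2 | a≡a%ℕn+[a/ℕn]*n (a + b + c + d) 2
  ... | suc (suc _) | s≤s (s≤s ()) | _ | _
  ... | 1 | _ | s | sum≡ = s , s - c - d , s - b - d , s - b - c , (begin
    pronic s + pronic (s - c - d) + pronic (s - b - d) + pronic (s - b - c)
      ≡⟨ solve 4 (λ s b c d → :pronic s :+ :pronic (s :- c :- d) :+ :pronic (s :- b :- d) :+ :pronic (s :- b :- c) :=
           (con 1ℤ :+ s :* con (+ 2) :- b :- c :- d) :* (con 1ℤ :+ s :* con (+ 2) :- b :- c :- d)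
             :+ b :* b :+ c :* c :+ d :* d :- con 1ℤ) refl s b c d ⟩
    sumSq (1ℤ + s * + 2 - b - c - d) b c d - 1ℤ ≡⟨ cong (λ t → sumSq (t - b - c - d) b c d - 1ℤ) sum≡ ⟨
    sumSq (a + b + c + d - b - c - d) b c d - 1ℤ
      ≡⟨ cong (λ t → sumSq t b c d - 1ℤ) (solve 4 (λ a b c d → a :+ b :+ c :+ d :- b :- c :- d := a) refl a b c d) ⟩
    sumSq a b c d - 1ℤ       ≡⟨ cong (_- 1ℤ) eq ⟨
    + suc (2 ℕ.* n) - 1ℤ     ≡⟨⟩
    + (2 ℕ.* n)              ∎)
    where open ≡-Reasoning
  -- A sum and the sum of squares have the same parity, and the latter is odd here; `half` is the
  -- explicit quotient by 2.
  ... | 0 | _ | s | sum≡ = contradiction (∣⇒∣ᵤ 2∣sum) 2∤sum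
    where
    half = s * s * + 2 - s * (b + c + d) * + 2 + b * b + c * c + d * d + b * c + b * d + c * d
    open ≡-Reasoning
    2∣sum : + 2 ℤᵈ.∣ + suc (2 ℕ.* n)
    2∣sum = ℤᵈ.divides half (begin
      + suc (2 ℕ.* n)  ≡⟨ eq ⟩
      sumSq a b c d    ≡⟨ cong (λ t → sumSq t b c d) (solve 4 (λ a b c d → a := a :+ b :+ c :+ d :- b :- c :- d) refl a b c d) ⟩
      sumSq (a + b + c + d - b - c - d) b c d ≡⟨ cong (λ t → sumSq (t - b - c - d) b c d) sum≡ ⟩
      sumSq (0ℤ + s * + 2 - b - c - d) b c d
        ≡⟨ solve 4 (λ s b c d →
             (con 0ℤ :+ s :* con (+ 2) :- b :- c :- d) :* (con 0ℤ :+ s :* con (+ 2) :- b :- c :- d)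
               :+ b :* b :+ c :* c :+ d :* d :=
             (s :* s :* con (+ 2) :- s :* (b :+ c :+ d) :* con (+ 2) :+ b :* b :+ c :* c :+ d :* d
               :+ b :* c :+ b :* d :+ c :* d) :* con (+ 2)) refl s b c d ⟩
      half * + 2 ∎)
    2∤sum : ¬ 2 ℕᵈ.∣ suc (2 ℕ.* n)
    2∤sum d = contradiction (ℕᵈ.∣m+n∣m⇒∣n (subst (2 ℕᵈ.∣_) (ℕₚ.+-comm 1 (2 ℕ.* n)) d) (ℕᵈ.m∣m*n n)) (from-no (2 ℕᵈ.∣? 1))

-- The small cases by search

pronicℕ : ℕ → ℕ
pronicℕ a = suc a ℕ.* (suc a ℕ.+ 1)

-- The shift in `pronicℕ` leaves out index 0. Index 16 already has pronic number 272 > 270; the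
-- tighter range for `a` and `b` shortens the search, and `table` confirms that it suffices.
Tabulated : ℕ → Set
Tabulated n = ∃ λ a → a ℕ.< 4 × ∃ λ b → b ℕ.< 4 × ∃ λ c → c ℕ.< 16 × ∃ λ d → d ℕ.< 16 ×
  pronicℕ a ℕ.+ pronicℕ b ℕ.+ pronicℕ c ℕ.+ pronicℕ d ≡ 2 ℕ.* n

tabulated? : ∀ n → Dec (Tabulated n)
tabulated? n = ℕₚ.anyUpTo? (λ a → ℕₚ.anyUpTo? (λ b → ℕₚ.anyUpTo? (λ c → ℕₚ.anyUpTo? (λ d →
  pronicℕ a ℕ.+ pronicℕ b ℕ.+ pronicℕ c ℕ.+ pronicℕ d ℕ.≟ 2 ℕ.* n) 16) 16) 4) 4

-- The exceptions of the theorem for k = 4, with 0 included.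
Exceptional : ℕ → Set
Exceptional n = n ℕ.< 4 ⊎ n ≡ 5 ⊎ n ≡ 7

table : ∀ {n} → n ℕ.< 136 → Exceptional n ⊎ Tabulated n
table = from-yes (ℕₚ.allUpTo? (λ n → (n ℕ.<? 4 ⊎-dec n ℕ.≟ 5 ⊎-dec n ℕ.≟ 7) ⊎-dec tabulated? n) 136)

fourPositivePronics : ∀ n → ¬ Exceptional n → IsSumOfPositive (+ (2 ℕ.* n))
fourPositivePronics n ¬exc = let a , b , c , d , eq = fourPronics n in conclude (sumOrSmall₄ a b c d eq)
  where
  lookup : Exceptional n ⊎ Tabulated n → IsSumOfPositive (+ (2 ℕ.* n))
  lookup (inj₁ exc) = contradiction exc ¬exc
  lookup (inj₂ (a , _ , b , _ , c , _ , d , _ , eq)) =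
    + suc a , + suc b , + suc c , + suc d , ((λ ()) , (λ ()) , (λ ()) , (λ ())) , cong +_ eq
  conclude : SumOrSmall (+ (2 ℕ.* n)) → IsSumOfPositive (+ (2 ℕ.* n))
  conclude (inj₁ good)  = good
  -- From 2n ≤ 270 follows n ≤ 135, hence the table length 136.
  conclude (inj₂ small) = lookup (table (s≤s (ℕₚ.*-cancelˡ-≤ 2 (ℤₚ.drop‿+≤+ small))))

-- From pronic to triangular numbers

triangle : ℕ → ℕ
triangle zero    = 0
triangle (suc n) = suc n ℕ.+ triangle n

2*triangle : ∀ n → 2 ℕ.* triangle n ≡ n ℕ.* (n ℕ.+ 1)
2*triangle zero    = refl
2*triangle (suc n) = begin
  2 ℕ.* (suc n ℕ.+ triangle n)         ≡⟨ ℕₚ.*-distribˡ-+ 2 (suc n) (triangle n) ⟩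
  2 ℕ.* suc n ℕ.+ 2 ℕ.* triangle n     ≡⟨ cong (2 ℕ.* suc n ℕ.+_) (2*triangle n) ⟩
  2 ℕ.* suc n ℕ.+ n ℕ.* (n ℕ.+ 1)      ≡⟨ lem n ⟩
  suc n ℕ.* (suc n ℕ.+ 1)              ∎
  where
  open ≡-Reasoning
  lem : ∀ n → 2 ℕ.* suc n ℕ.+ n ℕ.* (n ℕ.+ 1) ≡ suc n ℕ.* (suc n ℕ.+ 1)
  lem = ℕ-Solver.solve-∀

pronic-triangle : ∀ a → ∃ λ m → + (2 ℕ.* triangle m) ≡ pronic a
pronic-triangle (+ m)        = m , trans (cong +_ (2*triangle m)) (ℤₚ.pos-* m (m ℕ.+ 1))
pronic-triangle -[1+ zero ]  = 0 , refl
-- The index -(m + 2) is carried to m + 1 by a ↦ -1 - a.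
pronic-triangle -[1+ suc m ] = suc m , cong +_ (trans (2*triangle (suc m))
  (trans (ℕₚ.*-comm (suc m) (suc m ℕ.+ 1)) (cong (ℕ._* suc m) (ℕₚ.+-comm (suc m) 1))))

pronic-nonzeroTriangular : ∀ a → pronic a ≢ 0ℤ → ∃ λ t → IsNonzeroTriangular t × + (2 ℕ.* t) ≡ pronic a
pronic-nonzeroTriangular a a≢0 = let m , eq = pronic-triangle a in
  triangle m , ((λ t≡0 → a≢0 (trans (sym eq) (cong (λ t → + (2 ℕ.* t)) t≡0))) , a , eq) , eq

cons : ∀ {k n t} → IsNonzeroTriangular t → SumOfNonzeroTriangulars k n → SumOfNonzeroTriangulars (suc k) (t ℕ.+ n)
cons {t = t} t-tri (v , v-tri , eq) = (t ∷ᵥ v) , (λ { zero → t-tri ; (suc i) → v-tri i }) , cong (t ℕ.+_) eq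

four⇒sumOfFour : ∀ n → IsSumOfPositive (+ (2 ℕ.* n)) → SumOfNonzeroTriangulars 4 n
four⇒sumOfFour n (a , b , c , d , (a≢0 , b≢0 , c≢0 , d≢0) , eq) =
  let s , s-tri , es = pronic-nonzeroTriangular a a≢0
      t , t-tri , et = pronic-nonzeroTriangular b b≢0
      u , u-tri , eu = pronic-nonzeroTriangular c c≢0
      v , v-tri , ev = pronic-nonzeroTriangular d d≢0
  in subst (SumOfNonzeroTriangulars 4)
       (ℕₚ.*-cancelˡ-≡ _ n 2 (ℤₚ.+-injective (trans (cong +_ (regroup s t u v))
         (trans (cong₂ _+_ (cong₂ _+_ (cong₂ _+_ es et) eu) ev) eq))))
       (cons s-tri (cons t-tri (cons u-tri (cons v-tri ((λ ()) , (λ ()) , refl)))))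
  where
  regroup : ∀ s t u v → 2 ℕ.* (s ℕ.+ (t ℕ.+ (u ℕ.+ (v ℕ.+ 0)))) ≡ 2 ℕ.* s ℕ.+ 2 ℕ.* t ℕ.+ 2 ℕ.* u ℕ.+ 2 ℕ.* v
  regroup = ℕ-Solver.solve-∀

pad : ∀ j {k n} → SumOfNonzeroTriangulars k n → SumOfNonzeroTriangulars (j ℕ.+ k) (j ℕ.+ n)
pad zero    s = s
pad (suc j) s = cons {t = 1} ((λ ()) , 1ℤ , refl) (pad j s)

-- The exceptions are not attained

Excess : ℕ → Set
Excess e = e ≡ 0 ⊎ e ≡ 2 ⊎ 4 ℕ.≤ e

excess-+ : ∀ {d e} → Excess d → Excess e → Excess (d ℕ.+ e)
excess-+ (inj₁ refl)        e                  = e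
excess-+ (inj₂ (inj₁ refl)) (inj₁ refl)        = inj₂ (inj₁ refl)
excess-+ (inj₂ (inj₁ refl)) (inj₂ (inj₁ refl)) = inj₂ (inj₂ ℕₚ.≤-refl)
excess-+ (inj₂ (inj₁ refl)) (inj₂ (inj₂ 4≤e))  = inj₂ (inj₂ (ℕₚ.m≤n⇒m≤o+n 2 4≤e))
excess-+ (inj₂ (inj₂ 4≤d))  _                  = inj₂ (inj₂ (ℕₚ.m≤n⇒m≤n+o _ 4≤d))

triangle-excess : ∀ m → triangle m ≢ 0 → ∃ λ e → triangle m ≡ suc e × Excess e
triangle-excess 0 t≢0 = contradiction refl t≢0
triangle-excess 1 _   = 0 , refl , inj₁ refl
triangle-excess 2 _   = 2 , refl , inj₂ (inj₁ refl)
-- The excess unfolds to (m + 2) + ((m + 2) + ...), and each of the two outer terms is at least 2.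
triangle-excess (suc (suc (suc m))) _ = _ , refl , inj₂ (inj₂ (ℕₚ.+-mono-≤ {2} {2 ℕ.+ m} {2} (s≤s (s≤s z≤n))
  (ℕₚ.m≤n⇒m≤n+o (suc m ℕ.+ triangle m) (s≤s (s≤s z≤n)))))

nonzeroTriangular-excess : ∀ {t} → IsNonzeroTriangular t → ∃ λ e → t ≡ suc e × Excess e
nonzeroTriangular-excess {t} (t≢0 , x , eq) =
  let m , em = pronic-triangle x
      m≡t = ℕₚ.*-cancelˡ-≡ (triangle m) t 2 (ℤₚ.+-injective (trans em (sym eq)))
      e , te , exc = triangle-excess m (t≢0 ∘ trans (sym m≡t))
  in e , trans (sym m≡t) te , exc

sum-excess : ∀ k {n} → SumOfNonzeroTriangulars k n → ∃ λ e → n ≡ k ℕ.+ e × Excess e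
sum-excess zero    (_ , _ , refl) = 0 , refl , inj₁ refl
sum-excess (suc k) (v , v-tri , refl) =
  let d , ed , exc-d = nonzeroTriangular-excess (v-tri zero)
      e , ee , exc-e = sum-excess k ((v ∘ suc) , (v-tri ∘ suc) , refl)
  in d ℕ.+ e , trans (cong₂ ℕ._+_ ed ee) (regroup d k e) , excess-+ exc-d exc-e
  where
  regroup : ∀ d k e → suc d ℕ.+ (k ℕ.+ e) ≡ suc k ℕ.+ (d ℕ.+ e)
  regroup = ℕ-Solver.solve-∀

theorem3p12 : (k : ℕ) → 4 ≤ k → (n : ℕ) → 1 ≤ n →
    (SumOfNonzeroTriangulars k n ⇔
    (¬ (n < k ⊎ n ≡ k ℕ.+ 1 ⊎ n ≡ k ℕ.+ 3)))
theorem3p12 k 4≤k n _ = mk⇔ necessary sufficient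
  where
  necessary : SumOfNonzeroTriangulars k n → ¬ (n < k ⊎ n ≡ k ℕ.+ 1 ⊎ n ≡ k ℕ.+ 3)
  necessary s exceptional with sum-excess k s
  ... | e , refl , exc = impossible exceptional exc
    where
    impossible : k ℕ.+ e < k ⊎ k ℕ.+ e ≡ k ℕ.+ 1 ⊎ k ℕ.+ e ≡ k ℕ.+ 3 → ¬ Excess e
    impossible (inj₁ lt) _ = ℕₚ.m+n≮m k e lt
    impossible (inj₂ (inj₁ eq)) x with ℕₚ.+-cancelˡ-≡ k e 1 eq
    impossible (inj₂ (inj₁ eq)) (inj₂ (inj₂ (s≤s ()))) | refl
    impossible (inj₂ (inj₂ eq)) x with ℕₚ.+-cancelˡ-≡ k e 3 eq
    impossible (inj₂ (inj₂ eq)) (inj₂ (inj₂ (s≤s (s≤s (s≤s ()))))) | refl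
  sufficient : ¬ (n < k ⊎ n ≡ k ℕ.+ 1 ⊎ n ≡ k ℕ.+ 3) → SumOfNonzeroTriangulars k n
  -- With n = k + e, the value 1 is given to k - 4 summands, which leaves 4 + e for four. The
  -- exceptions 5 and 7 there are e = 1 and e = 3, that is n = k + 1 and n = k + 3.
  sufficient ¬exc = subst₂ SumOfNonzeroTriangulars j+4≡k j+[4+e]≡n
    (pad j (four⇒sumOfFour (4 ℕ.+ e) (fourPositivePronics (4 ℕ.+ e) ¬exceptional)))
    where
    j = k ℕ.∸ 4
    e = n ℕ.∸ k
    j+4≡k : j ℕ.+ 4 ≡ k
    j+4≡k = ℕₚ.m∸n+n≡m 4≤k
    k+e≡n : k ℕ.+ e ≡ n
    k+e≡n = ℕₚ.m+[n∸m]≡n (ℕₚ.≮⇒≥ (¬exc ∘ inj₁))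
    j+[4+e]≡n : j ℕ.+ (4 ℕ.+ e) ≡ n
    j+[4+e]≡n = trans (sym (ℕₚ.+-assoc j 4 e)) (trans (cong (ℕ._+ e) j+4≡k) k+e≡n)
    excluded : ∀ {c} → 4 ℕ.+ e ≡ 4 ℕ.+ c → n ≡ k ℕ.+ c
    excluded {c} eq = trans (sym k+e≡n) (cong (k ℕ.+_) (ℕₚ.+-cancelˡ-≡ 4 e c eq))
    ¬exceptional : ¬ Exceptional (4 ℕ.+ e)
    ¬exceptional (inj₁ lt)        = ℕₚ.m+n≮m 4 e lt
    ¬exceptional (inj₂ (inj₁ eq)) = ¬exc (inj₂ (inj₁ (excluded eq)))
    ¬exceptional (inj₂ (inj₂ eq)) = ¬exc (inj₂ (inj₂ (excluded eq)))
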